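{- Let $p$ be a prime, let $k\geq 1$, and let $a_1,a_2,\ldots,a_k\geq 2$ be integers. Further let $n$ be a non-negative integer with $n\leq 1+2\sum_{i=1}^k(a_i-1)$. Then there exists a spherical latin bitrade whose canonical group is isomorphic to $$\mathbb{Z}_p^n\oplus\left(\bigoplus_{i=1}^k\mathbb{Z}_{pa_i}\right).$$
   Context: Partial latin square: given finite, pairwise disjoint sets $R$ (rows), $C$ (columns), $S$ (symbols), a partial latin square is a subset $P\subseteq R\times C\times S$ such that any two distinct triples of $P$ agree in at most one coordinate; it is assumed that every element of $R$, $C$ and $S$ occurs in some triple of $P$. Latin bitrade: an ordered pair $(W,B)$ of non-empty partial latin squares (with common sets $R,C,S$) such that for each triple $(r,c,s)\in W$ (respectively $B$) there exist unique $r'\neq r$, $c'\neq c$, $s'\neq s$ with $\{(r',c,s),(r,c',s),(r,c,s')\}\subset B$ (respectively $W$). Its size is $|W|=|B|$. It is connected if there is no latin bitrade $(W',B')$ with $W'\subsetneq W$ and $B'\subsetneq B$. Separated: for each row $r$, define a permutation $\rho_r$ of the symbols in row $r$ by $\rho_r(s)=s'$ if and only if $(r,c,s)\in W$ and $(r,c,s')\in B$ for some $c\in C$; the row $r$ is separated if $\rho_r$ is a single cycle. Separated columns and symbols are defined analogously. The bitrade is separated if every row, column and symbol is separated. Spherical: from a connected separated latin bitrade $(W,B)$ construct a face two-coloured triangulation of a closed orientable surface with vertex set $R\sqcup C\sqcup S$, with an edge between two vertices if and only if they occur together in a triple of $W$ (equivalently of $B$), a white triangular face with vertices $r,c,s$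 for each $(r,c,s)\in W$, and a black triangular face with vertices $r,c,s$ for each $(r,c,s)\in B$. A spherical latin bitrade is a connected separated latin bitrade for which this surface is the sphere (equivalently, a connected latin bitrade with $|R|+|C|+|S|=|W|+2$). Canonical group: for a partial latin square $P$ with sets $R,C,S$, let $\mathcal{A}_P$ be the abelian group with generating set $R\cup C\cup S$ subject to the relations $r+c+s=0$ for all $(r,c,s)\in P$. It is known that for a spherical latin bitrade $(W,B)$ one has $\mathcal{A}_W\cong\mathcal{A}_B\cong\mathbb{Z}\oplus\mathbb{Z}\oplus\mathcal{C}$ with $\mathcal{C}$ finite. The group $\mathcal{C}$ (the torsion subgroup of $\mathcal{A}_W$) is called the canonical group of $(W,B)$. $\mathbb{Z}_n$ denotes the cyclic group of order $n$. -}

module Defs where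

open import Algebra.Bundles using (AbelianGroup; RawGroup)
open import Algebra.Morphism.Structures using (module GroupMorphisms)
import Algebra.Construct.DirectProduct as DirectProduct
import Algebra.Morphism.GroupMonomorphism as GroupMonomorphism
import Algebra.Properties.CommutativeMonoid.Mult as Mult
open import Data.Bool.Base using (Bool; true; false; T; if_then_else_; _∨_)
open import Data.Fin.Base using (Fin)
open import Data.Integer.Base as ℤ using (ℤ; +_)
import Data.Integer.Properties as ℤ
open import Data.Integer.Divisibility.Signed as ℤ∣ using (_∣_)
open import Data.Nat.Base as ℕ using (ℕ; zero; suc; _≤_; s≤s; z≤n)
import Data.Nat.Properties as ℕ
open import Data.Product.Base using (Σ; ∃; _×_; _,_; proj₁; proj₂)
open import Data.Product using (∃!)
open import Data.Sum.Base using (_⊎_; inj₁; inj₂)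
open import Data.Vec.Functional using (Vector; foldr)
open import Function.Base using (_∘_; id)
open import Level using (Level; 0ℓ; _⊔_)
open import Relation.Binary.Construct.Closure.ReflexiveTransitive using (Star)
open import Relation.Binary.Core using (Rel)
open import Relation.Binary.PropositionalEquality as ≡ using (_≡_; _≢_)
open import Relation.Nullary.Negation.Core using (¬_)
open import Relation.Unary using (Pred; _∈_; _⊂_)

open import Algebra.Properties.CommutativeMonoid.Sum ℕ.+-0-commutativeMonoid
  using (sum-syntax) public

------------------------------------------------------------------------
-- Abelian groups

private
  variable
    c ℓ c₁ ℓ₁ c₂ ℓ₂ : Level

infix 4 _≅_

_≅_ : AbelianGroup c₁ ℓ₁ → AbelianGroup c₂ ℓ₂ → Set (c₁ ⊔ ℓ₁ ⊔ c₂ ⊔ ℓ₂)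
G ≅ H = Σ (G.Carrier → H.Carrier) (GroupMorphisms.IsGroupIsomorphism G.rawGroup H.rawGroup)
  where
  module G = AbelianGroup G
  module H = AbelianGroup H

infixr 6 _⊕_

_⊕_ : AbelianGroup c₁ ℓ₁ → AbelianGroup c₂ ℓ₂ → AbelianGroup (c₁ ⊔ c₂) (ℓ₁ ⊔ ℓ₂)
_⊕_ = DirectProduct.abelianGroup

-- The index set is finite, so the direct sum consists of all tuples.

⨁ : ∀ {k} → Vector (AbelianGroup c ℓ) k → AbelianGroup c ℓ
⨁ {k = k} G = record
  { Carrier = ∀ i → G.Carrier i
  ; _≈_     = λ x y → ∀ i → G._≈_ i (x i) (y i)
  ; _∙_     = λ x y i → G._∙_ i (x i) (y i)
  ; ε       = λ i → G.ε i
  ; _⁻¹     = λ x i → G._⁻¹ i (x i)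
  ; isAbelianGroup = record
    { isGroup = record
      { isMonoid = record
        { isSemigroup = record
          { isMagma = record
            { isEquivalence = record
              { refl  = λ i → G.refl i
              ; sym   = λ e i → G.sym i (e i)
              ; trans = λ e f i → G.trans i (e i) (f i)
              }
            ; ∙-cong = λ e f i → G.∙-cong i (e i) (f i)
            }
          ; assoc = λ x y z i → G.assoc i (x i) (y i) (z i)
          }
        ; identity = (λ x i → G.identityˡ i (x i)) , (λ x i → G.identityʳ i (x i))
        }
      ; inverse = (λ x i → G.inverseˡ i (x i)) , (λ x i → G.inverseʳ i (x i))
      ; ⁻¹-cong = λ e i → G.⁻¹-cong i (e i)
      }
    ; comm = λ x y i → G.comm i (x i) (y i)
    }
  }
  where module G (i : Fin k) = AbelianGroup (G i)

record Congruent (m : ℕ) (x y : ℤ) : Set where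
  constructor congruent
  field
    difference-divisible : + m ∣ x ℤ.- y

-- The setoid quotient of the integers by congruence modulo m: cyclic of order
-- m when m is positive (and ℤ/ 0 is ℤ).

ℤ/_ : ℕ → AbelianGroup 0ℓ 0ℓ
ℤ/ m = record
  { Carrier = ℤ
  ; _≈_     = _≈_
  ; _∙_     = ℤ._+_
  ; ε       = ℤ.0ℤ
  ; _⁻¹     = ℤ.-_
  ; isAbelianGroup = record
    { isGroup = record
      { isMonoid = record
        { isSemigroup = record
          { isMagma = record
            { isEquivalence = record
              { refl  = reflexive ≡.refl
              ; sym   = sym
              ; trans = trans
              }
            ; ∙-cong = +-cong-mod
            }
          ; assoc = λ x y z → reflexive (ℤ.+-assoc x y z)
          }
        ; identity = reflexive ∘ ℤ.+-identityˡ , reflexive ∘ ℤ.+-identityʳ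
        }
      ; inverse = reflexive ∘ ℤ.+-inverseˡ , reflexive ∘ ℤ.+-inverseʳ
      ; ⁻¹-cong = neg-cong-mod
      }
    ; comm = λ x y → reflexive (ℤ.+-comm x y)
    }
  }
  where
  open import Data.Integer.Tactic.RingSolver using (solve-∀)

  _≈_ : Rel ℤ 0ℓ
  _≈_ = Congruent m

  reflexive : ∀ {x y} → x ≡ y → x ≈ y
  reflexive {x} ≡.refl = congruent (ℤ∣.divides ℤ.0ℤ (ℤ.+-inverseʳ x))

  sym : ∀ {x y} → x ≈ y → y ≈ x
  sym {x} {y} (congruent e) =
    congruent (≡.subst (+ m ∣_) (lem x y) (ℤ∣.∣m⇒∣-m e))
    where
    lem : ∀ x y → ℤ.- (x ℤ.- y) ≡ y ℤ.- x
    lem = solve-∀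

  trans : ∀ {x y z} → x ≈ y → y ≈ z → x ≈ z
  trans {x} {y} {z} (congruent e) (congruent f) =
    congruent (≡.subst (+ m ∣_) (lem x y z) (ℤ∣.∣m∣n⇒∣m+n e f))
    where
    lem : ∀ x y z → (x ℤ.- y) ℤ.+ (y ℤ.- z) ≡ x ℤ.- z
    lem = solve-∀

  +-cong-mod : ∀ {x y u v} → x ≈ y → u ≈ v → (x ℤ.+ u) ≈ (y ℤ.+ v)
  +-cong-mod {x} {y} {u} {v} (congruent e) (congruent f) =
    congruent (≡.subst (+ m ∣_) (lem x y u v) (ℤ∣.∣m∣n⇒∣m+n e f))
    where
    lem : ∀ x y u v → (x ℤ.- y) ℤ.+ (u ℤ.- v) ≡ (x ℤ.+ u) ℤ.- (y ℤ.+ v)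
    lem = solve-∀

  neg-cong-mod : ∀ {x y} → x ≈ y → (ℤ.- x) ≈ (ℤ.- y)
  neg-cong-mod {x} {y} (congruent e) =
    congruent (≡.subst (+ m ∣_) (lem x y) (ℤ∣.∣m⇒∣-m e))
    where
    lem : ∀ x y → ℤ.- (x ℤ.- y) ≡ ℤ.- x ℤ.- (ℤ.- y)
    lem = solve-∀

module _ (G : AbelianGroup c ℓ) where
  open AbelianGroup G
  open Mult commutativeMonoid using (×-congʳ; ×-distrib-+; ×-assocˡ; ×-congˡ)
    renaming (_×_ to _·_)

  IsTorsion : Pred Carrier ℓ
  IsTorsion x = ∃ λ m → 1 ≤ m × m · x ≈ ε

  private
    ·-ε : ∀ m → m · ε ≈ ε
    ·-ε zero    = refl
    ·-ε (suc m) = trans (identityˡ _) (·-ε m)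

    kill : ∀ m n {x} → n · x ≈ ε → (m ℕ.* n) · x ≈ ε
    kill m n {x} e = trans (sym (×-assocˡ x m n)) (trans (×-congʳ m e) (·-ε m))

    torsion-ε : IsTorsion ε
    torsion-ε = 1 , s≤s z≤n , ·-ε 1

    torsion-∙ : ∀ {x y} → IsTorsion x → IsTorsion y → IsTorsion (x ∙ y)
    torsion-∙ {x} {y} (m , 1≤m , e) (n , 1≤n , f) =
      m ℕ.* n , ℕ.*-mono-≤ 1≤m 1≤n ,
      trans (×-distrib-+ x y (m ℕ.* n))
        (trans (∙-cong (trans (×-congˡ (ℕ.*-comm m n)) (kill n m e)) (kill m n f))
               (identityˡ ε))

    torsion-⁻¹ : ∀ {x} → IsTorsion x → IsTorsion (x ⁻¹)
    torsion-⁻¹ {x} (m , 1≤m , e) = m , 1≤m ,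
      trans (sym (identityʳ _))
        (trans (∙-congˡ (sym e))
          (trans (sym (×-distrib-+ (x ⁻¹) x m))
            (trans (×-congʳ m (inverseˡ x)) (·-ε m))))

    rawTorsion : RawGroup (c ⊔ ℓ) ℓ
    rawTorsion = record
      { Carrier = Σ Carrier IsTorsion
      ; _≈_     = λ x y → proj₁ x ≈ proj₁ y
      ; _∙_     = λ (x , tx) (y , ty) → x ∙ y , torsion-∙ tx ty
      ; ε       = ε , torsion-ε
      ; _⁻¹     = λ (x , tx) → x ⁻¹ , torsion-⁻¹ tx
      }

  torsionSubgroup : AbelianGroup (c ⊔ ℓ) ℓ
  torsionSubgroup = record
    { RawGroup rawTorsion
    ; isAbelianGroup = GroupMonomorphism.isAbelianGroup inclusion isAbelianGroup
    }
    where
    inclusion : GroupMorphisms.IsGroupMonomorphism rawTorsion rawGroup proj₁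
    inclusion = record
      { isGroupHomomorphism = record
        { isMonoidHomomorphism = record
          { isMagmaHomomorphism = record
            { isRelHomomorphism = record { cong = id }
            ; homo = λ _ _ → refl
            }
          ; ε-homo = refl
          }
        ; ⁻¹-homo = λ _ → refl
        }
      ; injective = id
      }

------------------------------------------------------------------------
-- Abelian groups given by generators and relations

infixl 6 _⊞_
infix  8 ⊟_

data Term (X : Set) : Set where
  gen : X → Term X
  𝟎   : Term X
  _⊞_ : Term X → Term X → Term X
  ⊟_  : Term X → Term X

module _ {X : Set} (Relator : Pred (Term X) 0ℓ) where

  infix 4 _≋_

  -- The least congruence that satisfies the laws of abelian groups and
  -- identifies every relator with zero.

  data _≋_ : Rel (Term X) 0ℓ where
    ≋-relator   : ∀ {t} → t ∈ Relator → t ≋ 𝟎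
    ≋-refl      : ∀ {t} → t ≋ t
    ≋-sym       : ∀ {t u} → t ≋ u → u ≋ t
    ≋-trans     : ∀ {t u v} → t ≋ u → u ≋ v → t ≋ v
    ⊞-cong      : ∀ {t t′ u u′} → t ≋ t′ → u ≋ u′ → t ⊞ u ≋ t′ ⊞ u′
    ⊟-cong      : ∀ {t t′} → t ≋ t′ → ⊟ t ≋ ⊟ t′
    ⊞-assoc     : ∀ t u v → (t ⊞ u) ⊞ v ≋ t ⊞ (u ⊞ v)
    ⊞-comm      : ∀ t u → t ⊞ u ≋ u ⊞ t
    ⊞-identityˡ : ∀ t → 𝟎 ⊞ t ≋ t
    ⊞-inverseˡ  : ∀ t → ⊟ t ⊞ t ≋ 𝟎

⟨_∣_⟩ : (X : Set) → Pred (Term X) 0ℓ → AbelianGroup 0ℓ 0ℓ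
⟨ X ∣ Relator ⟩ = record
  { Carrier = Term X
  ; _≈_     = _≋_ Relator
  ; _∙_     = _⊞_
  ; ε       = 𝟎
  ; _⁻¹     = ⊟_
  ; isAbelianGroup = record
    { isGroup = record
      { isMonoid = record
        { isSemigroup = record
          { isMagma = record
            { isEquivalence = record { refl = ≋-refl ; sym = ≋-sym ; trans = ≋-trans }
            ; ∙-cong = ⊞-cong
            }
          ; assoc = ⊞-assoc
          }
        ; identity = ⊞-identityˡ , λ t → ≋-trans (⊞-comm t 𝟎) (⊞-identityˡ t)
        }
      ; inverse = ⊞-inverseˡ , λ t → ≋-trans (⊞-comm t (⊟ t)) (⊞-inverseˡ t)
      ; ⁻¹-cong = ⊟-cong
      }
    ; comm = ⊞-comm
    }
  }

------------------------------------------------------------------------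
-- Partial latin squares and latin bitrades

-- R, C and S are the sets Fin nR, Fin nC and Fin nS.  They are distinct
-- components of a product (and of a disjoint union below), so they count as
-- pairwise disjoint.

module _ (nR nC nS : ℕ) where

  Triple : Set
  Triple = Fin nR × Fin nC × Fin nS

  TripleSet : Set
  TripleSet = Triple → Bool

any : ∀ {n} → Vector Bool n → Bool
any = foldr _∨_ false

module _ {nR nC nS : ℕ} where

  ⟦_⟧ : TripleSet nR nC nS → Pred (Triple nR nC nS) 0ℓ
  ⟦ P ⟧ t = T (P t)

  AgreeTwice : Rel (Triple nR nC nS) 0ℓ
  AgreeTwice (r , c , s) (r′ , c′ , s′) =
    (r ≡ r′ × c ≡ c′) ⊎ (r ≡ r′ × s ≡ s′) ⊎ (c ≡ c′ × s ≡ s′)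

  -- That every row, column and symbol occurs is the separate condition
  -- `Exhaustive`: it fixes the sets R, C and S belonging to P, and it is
  -- imposed on a bitrade but not on the smaller bitrades inside it, whose row,
  -- column and symbol sets are whichever subsets they use.

  IsPartialLatinSquare : TripleSet nR nC nS → Set
  IsPartialLatinSquare P =
    ∀ {t u} → t ∈ ⟦ P ⟧ → u ∈ ⟦ P ⟧ → t ≢ u → ¬ AgreeTwice t u

  record Exhaustive (P : TripleSet nR nC nS) : Set where
    field
      row-occurs    : ∀ r → ∃ λ c → ∃ λ s → (r , c , s) ∈ ⟦ P ⟧
      column-occurs : ∀ c → ∃ λ r → ∃ λ s → (r , c , s) ∈ ⟦ P ⟧
      symbol-occurs : ∀ s → ∃ λ r → ∃ λ c → (r , c , s) ∈ ⟦ P ⟧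

  HasUniqueMates : (P Q : TripleSet nR nC nS) → Set
  HasUniqueMates P Q = ∀ {r c s} → (r , c , s) ∈ ⟦ P ⟧ →
    ∃! _≡_ (λ r′ → r′ ≢ r × (r′ , c , s) ∈ ⟦ Q ⟧) ×
    ∃! _≡_ (λ c′ → c′ ≢ c × (r , c′ , s) ∈ ⟦ Q ⟧) ×
    ∃! _≡_ (λ s′ → s′ ≢ s × (r , c , s′) ∈ ⟦ Q ⟧)

  record IsLatinBitrade (W B : TripleSet nR nC nS) : Set where
    field
      W-nonEmpty : ∃ λ t → t ∈ ⟦ W ⟧
      B-nonEmpty : ∃ λ t → t ∈ ⟦ B ⟧
      W-isPLS    : IsPartialLatinSquare W
      B-isPLS    : IsPartialLatinSquare B
      W-mates    : HasUniqueMates W B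
      B-mates    : HasUniqueMates B W

  size : TripleSet nR nC nS → ℕ
  size P = ∑[ r < nR ] ∑[ c < nC ] ∑[ s < nS ] (if P (r , c , s) then 1 else 0)

  -- The number of pairs of vertices that occur together in a triple.

  edges : TripleSet nR nC nS → ℕ
  edges P =
    (∑[ r < nR ] ∑[ c < nC ] (if any (λ s → P (r , c , s)) then 1 else 0)) ℕ.+
    (∑[ r < nR ] ∑[ s < nS ] (if any (λ c → P (r , c , s)) then 1 else 0)) ℕ.+
    (∑[ c < nC ] ∑[ s < nS ] (if any (λ r → P (r , c , s)) then 1 else 0))

-- The graph ρ of a permutation of the set D has a single cycle when each
-- element of D can be reached from each other one by iterating ρ.

SingleCycle : {X : Set} → Pred X 0ℓ → Rel X 0ℓ → Set
SingleCycle D ρ = ∀ {x y} → x ∈ D → y ∈ D → Star ρ x y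

record LatinBitrade : Set where
  field
    {nR nC nS}     : ℕ
    W B            : TripleSet nR nC nS
    isLatinBitrade : IsLatinBitrade W B
    W-exhaustive   : Exhaustive W
    B-exhaustive   : Exhaustive B

  IsConnected : Set
  IsConnected = ¬ (∃ λ (W′ : TripleSet nR nC nS) → ∃ λ (B′ : TripleSet nR nC nS) →
    IsLatinBitrade W′ B′ × ⟦ W′ ⟧ ⊂ ⟦ W ⟧ × ⟦ B′ ⟧ ⊂ ⟦ B ⟧)

  -- Rows permute symbols, columns permute rows, symbols permute columns: the
  -- three cases correspond under cyclically shifting the coordinates.

  RowSeparated : Fin nR → Set
  RowSeparated r = SingleCycle
    (λ s → ∃ λ c → (r , c , s) ∈ ⟦ W ⟧)
    (λ s s′ → ∃ λ c → (r , c , s) ∈ ⟦ W ⟧ × (r , c , s′) ∈ ⟦ B ⟧)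

  ColumnSeparated : Fin nC → Set
  ColumnSeparated c = SingleCycle
    (λ r → ∃ λ s → (r , c , s) ∈ ⟦ W ⟧)
    (λ r r′ → ∃ λ s → (r , c , s) ∈ ⟦ W ⟧ × (r′ , c , s) ∈ ⟦ B ⟧)

  SymbolSeparated : Fin nS → Set
  SymbolSeparated s = SingleCycle
    (λ c → ∃ λ r → (r , c , s) ∈ ⟦ W ⟧)
    (λ c c′ → ∃ λ r → (r , c , s) ∈ ⟦ W ⟧ × (r , c′ , s) ∈ ⟦ B ⟧)

  IsSeparated : Set
  IsSeparated = (∀ r → RowSeparated r) × (∀ c → ColumnSeparated c) × (∀ s → SymbolSeparated s)

  -- Vertices − edges + faces of the surface triangulated by the white faces W
  -- and the black faces B.

  eulerCharacteristic : ℤ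
  eulerCharacteristic =
    + (nR ℕ.+ nC ℕ.+ nS) ℤ.- + edges W ℤ.+ + (size W ℕ.+ size B)

  -- The surface of a connected separated bitrade is connected, closed and
  -- orientable, hence it is the sphere exactly when its Euler characteristic
  -- is 2.

  record IsSpherical : Set where
    field
      isConnected : IsConnected
      isSeparated : IsSeparated
      isSphere    : eulerCharacteristic ≡ + 2

  data Relator : Pred (Term (Fin nR ⊎ Fin nC ⊎ Fin nS)) 0ℓ where
    triple : ∀ {r c s} → (r , c , s) ∈ ⟦ W ⟧ →
             Relator (gen (inj₁ r) ⊞ gen (inj₂ (inj₁ c)) ⊞ gen (inj₂ (inj₂ s)))

  𝒜 : AbelianGroup 0ℓ 0ℓ
  𝒜 = ⟨ Fin nR ⊎ Fin nC ⊎ Fin nS ∣ Relator ⟩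

  canonicalGroup : AbelianGroup 0ℓ 0ℓ
  canonicalGroup = torsionSubgroup 𝒜

-- A spherical bitrade is a plane Eulerian digraph in which arcs in and out of
-- each vertex alternate: rows are the vertices, columns and symbols the faces on
-- the two sides of an arc, and an arc is a white triangle at its head and a black
-- one at its tail.  Mapping the rows to an abelian group, a vertex t that receives
-- p arcs from w and returns p − 1 to w and one to w′ imposes p (t − w) = w′ − w.
--
-- Start with a loop at a hub, where the torsion is trivial.  Splitting an arc w → w′ by
-- such a vertex t, and sending one of the arcs t → w through a further vertex v
-- with a arcs v → w and a − 1 arcs w → v, adds the relations
-- p (t − w) = (w′ − w) + (v − w) and a (v − w) = 0.  When w′ − w is divisible by p
-- this adds a summand ℤ/pa, it uses up one arc along which the difference is
-- divisible by p, and it supplies 2a − 1 new ones, those between v and w.  Splitting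
-- an arc of this kind by t alone adds a summand ℤ/p and uses up the arc.  After the
-- summands ℤ/pa₁, …, ℤ/paₖ there are 1 + 2 ∑ (aᵢ − 1) such arcs left for the ℤ/p.

module Submission where

open import Defs
open import Data.Nat using (ℕ; _+_; _*_; _∸_; _≤_)
open import Data.Nat.Primality using (Prime)
open import Data.Product using (Σ; _×_)
open import Data.Vec.Functional using (Vector; replicate)
open LatinBitrade using (IsSpherical; canonicalGroup)

open import Algebra.Bundles using (AbelianGroup)
import Algebra.Morphism.Construct.Composition as Composition
open import Algebra.Morphism.Structures using (module GroupMorphisms)
import Algebra.Properties.AbelianGroup as AbelianGroupProperties
import Algebra.Properties.CommutativeMonoid.Mult as Mult
import Algebra.Properties.CommutativeMonoid.Sum as CommutativeMonoidSum
open import Data.Bool.Base using (Bool; true; false; T; if_then_else_)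
open import Data.Bool.Properties using (T-∨)
open import Data.Fin.Base using (Fin; zero; suc; punchOut)
open import Data.Fin.Patterns
open import Data.Fin.Properties
  using (_≟_; suc-injective; any?; injective⇒≤; punchOut-injective)
open import Data.Integer.Base as ℤ using (ℤ; -[1+_]; _⊖_)
open import Data.Integer.Divisibility.Signed using (divides)
import Data.Integer.Properties as ℤ
import Data.Integer.Tactic.RingSolver as ℤSolver
open import Data.Nat.Base as ℕ using (zero; suc; s≤s; z≤n)
import Data.Nat.Properties as ℕ
import Data.Nat.Tactic.RingSolver as ℕSolver
open import Data.Product.Base using (∃; _,_; proj₁; proj₂)
open import Data.Product.Properties using (≡-dec)
open import Data.Sum.Base using (_⊎_; inj₁; inj₂)
import Data.Vec.Base as Vec
open import Data.Vec.Base using (tabulate)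
open import Data.Vec.Functional using ([]; _∷_; updateAt)
open import Data.Vec.Functional.Properties using (updateAt-updates; updateAt-minimal)
open import Data.Vec.Properties using (lookup∘tabulate)
open import Function.Base using (_∘_; const; id)
open import Function.Bundles using (Equivalence)
open import Level using (Level; 0ℓ)
open import Relation.Binary.Construct.Closure.ReflexiveTransitive as Star
  using (Star; _◅_; _◅◅_; gmap; kleisliStar) renaming (ε to done)
open import Relation.Binary.Construct.Closure.Transitive
  using (TransClosure; [_]; _∷ʳ_; _++_) renaming (_∷_ to _◅⁺_)
open import Relation.Binary.Core using (Rel)
open import Relation.Binary.PropositionalEquality as ≡ using (_≡_; _≢_; cong; cong₂; subst)
open import Relation.Nullary.Decidable.Core
  using (Dec; yes; no; does; toWitness; fromWitness; isYes)
open import Relation.Nullary.Negation.Core using (¬_; contradiction)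
open CommutativeMonoidSum ℕ.+-0-commutativeMonoid using (sum; ∑-comm; sum-cong-≗; sum-replicate-zero)

-- The number of arcs that a splitting adds grows with `p` and `a`. Bundles of parallel arcs are
-- therefore kept as single arcs with an `excess`: a splitting by `t` alone is one `subdivide`, one
-- with `v` as well is two of them around a single `unbundle`, and opening a bundle never changes
-- the group. The price is that intermediate maps need not be bitrades: two arcs may share both
-- faces as long as one of them is a bundle, and the initial loop must be tolerated until it is
-- split.
--
-- The group is tracked through what it classifies. A labelling of the vertices of the final map in
-- an abelian group `H` that satisfies the relations is the same as a homomorphism from `𝒜` to `H`.
-- `Coordinates` asserts, for all `H` at once, that such labellings are governed by `G` and by two
-- free parameters, the labels of one row and one column. In this form the claim passes from map to
-- map without a presentation for each; the presented group enters only at the end, as one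
-- particular `H` labelled by its own generators. The free parameters account for ℤ ⊕ ℤ, and `G` is
-- the torsion.

-- A directed map on the sphere: rows are vertices, columns and symbols are the
-- faces on the two sides of an arc.  An arc of excess e stands for a bundle of
-- 2e + 1 parallel arcs, e of them reversed, bounding 2e digons.

record Map : Set where
  field
    {nR nC nS nA} : ℕ
    tail head     : Vector (Fin nR) nA
    col           : Vector (Fin nC) nA
    symb          : Vector (Fin nS) nA
    excess        : Vector ℕ nA

module _ (M : Map) where
  open Map M

  Consecutive : ∀ {X : Set} → (Fin nA → X) → Rel (Fin nA) 0ℓ
  Consecutive face a b = head a ≡ tail b × face a ≡ face b

  -- The path is non-empty so that the case of equal arcs still provides every arc with a successor
  -- and a predecessor along its face.
  Cyclic : ∀ {X : Set} → (Fin nA → X) → Set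
  Cyclic face = ∀ {a b} → face a ≡ face b → TransClosure (Consecutive face) a b

  -- One step of the permutation of the symbols in row `r`: the white triangle of `a` and the black
  -- triangle of `b` meet `r` in the same column.
  RowStep : Fin nR → Rel (Fin nS) 0ℓ
  RowStep r s s′ = ∃ λ a → ∃ λ b →
    head a ≡ r × tail b ≡ r × col a ≡ col b × symb a ≡ s × symb b ≡ s′

  SharesFace : Rel (Fin nA) 0ℓ
  SharesFace a b = col a ≡ col b ⊎ symb a ≡ symb b

  Loopless : Set
  Loopless = ∀ a → tail a ≢ head a

  -- An arc of positive excess stands for several arcs with distinct pairs of
  -- faces, so only arcs of excess 0 must be determined by their two faces.
  record Spherical : Set where
    field
      tail-col-injective : ∀ {a b} → tail a ≡ tail b → col a ≡ col b → a ≡ b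
      tail-sym-injective : ∀ {a b} → tail a ≡ tail b → symb a ≡ symb b → a ≡ b
      col-sym-injective  : ∀ {a b} → excess a ≡ 0 → excess b ≡ 0 →
                           col a ≡ col b → symb a ≡ symb b → a ≡ b
      col-cyclic         : Cyclic col
      sym-cyclic         : Cyclic symb
      row-cyclic         : ∀ r {a b} → head a ≡ r → head b ≡ r → Star (RowStep r) (symb a) (symb b)
      connected          : ∀ a b → Star SharesFace a b
      row-occurs         : ∀ r → ∃ λ a → tail a ≡ r
      col-occurs         : ∀ c → ∃ λ a → col a ≡ c
      sym-occurs         : ∀ s → ∃ λ a → symb a ≡ s
      euler              : nR + nC + nS ≡ 2 + nA

-- Paths and updated vectors

module _ {A B : Set} {R : Rel A 0ℓ} {S : Rel B 0ℓ} (f : A → B)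
         (step : ∀ {x y} → R x y → TransClosure S (f x) (f y)) where

  bind⁺ : ∀ {x y} → TransClosure R x y → TransClosure S (f x) (f y)
  bind⁺ [ s ]    = step s
  bind⁺ (s ◅⁺ ss) = step s ++ bind⁺ ss

splitLast : ∀ {A : Set} {R : Rel A 0ℓ} {x y} → TransClosure R x y →
            ∃ λ z → (x ≡ z ⊎ TransClosure R x z) × R z y
splitLast [ s ] = _ , inj₁ ≡.refl , s
splitLast (s ◅⁺ ss) with splitLast ss
... | z , inj₁ ≡.refl , t = z , inj₂ [ s ] , t
... | z , inj₂ ts   , t = z , inj₂ (s ◅⁺ ts) , t

firstStep : ∀ {A : Set} {R : Rel A 0ℓ} {x y} → TransClosure R x y → ∃ (R x)
firstStep [ s ]   = _ , s
firstStep (s ◅⁺ _) = _ , s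

data UpdateView {n} {A : Set} (xs : Vector A n) (i : Fin n) (f : A → A) (j : Fin n) : Set where
  updated   : j ≡ i → updateAt xs i f j ≡ f (xs i) → UpdateView xs i f j
  untouched : j ≢ i → updateAt xs i f j ≡ xs j → UpdateView xs i f j

updateView : ∀ {n} {A : Set} (xs : Vector A n) i f j → UpdateView xs i f j
updateView xs i f j with j ≟ i
... | yes ≡.refl = updated ≡.refl (updateAt-updates i xs)
... | no j≢i   = untouched j≢i (updateAt-minimal j i xs j≢i)

-- Subdividing an arc

-- The arc x from w to w′ becomes a new arc of excess i from w to a new vertex,
-- followed by x, now of excess j, from the new vertex to w′.

module Subdivision (M : Map) (x : Fin (Map.nA M)) (i j : ℕ) where
  open Map M

  private
    shifted : Vector (Fin (suc nR)) nA
    shifted a = suc (tail a)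

  subdivide : Map
  subdivide = record
    { nR     = suc nR
    ; nC     = nC
    ; nS     = nS
    ; nA     = suc nA
    ; tail   = λ { zero → suc (tail x) ; (suc a) → updateAt shifted x (const zero) a }
    ; head   = λ { zero → zero         ; (suc a) → suc (head a) }
    ; col    = λ { zero → col x        ; (suc a) → col a }
    ; symb   = λ { zero → symb x       ; (suc a) → symb a }
    ; excess = λ { zero → i            ; (suc a) → updateAt excess x (const j) a }
    }

  private
    module M′ = Map subdivide

  tail-x : M′.tail (suc x) ≡ zero
  tail-x = updateAt-updates x shifted

  tail-≢ : ∀ {a} → a ≢ x → M′.tail (suc a) ≡ suc (tail a)
  tail-≢ {a} = updateAt-minimal a x shifted

  excess-x : M′.excess (suc x) ≡ j
  excess-x = updateAt-updates x excess

  excess-≢ : ∀ {a} → a ≢ x → M′.excess (suc a) ≡ excess a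
  excess-≢ {a} = updateAt-minimal a x excess

  private
    tail-suc : ∀ {a r} → M′.tail (suc a) ≡ suc r → a ≢ x × tail a ≡ r
    tail-suc {a} e with updateView shifted x (const zero) a
    ... | updated ≡.refl q  = contradiction (≡.trans (≡.sym q) e) λ ()
    ... | untouched a≢x q = a≢x , suc-injective (≡.trans (≡.sym q) e)

  module _ {X : Set} (face : Fin nA → X) (face′ : Fin (suc nA) → X)
           (face′-zero : face′ zero ≡ face x) (face′-suc : ∀ a → face′ (suc a) ≡ face a) where
    private
      C  = Consecutive M face
      C′ = Consecutive subdivide face′

      zero⇝x : C′ zero (suc x)
      zero⇝x = ≡.sym tail-x , ≡.trans face′-zero (≡.sym (face′-suc x))

      ⇝zero : ∀ {a} → C a x → C′ (suc a) zero
      ⇝zero (h , e) = cong suc h , ≡.trans (face′-suc _) (≡.trans e (≡.sym face′-zero))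

      step : ∀ {a b} → C a b → TransClosure C′ (suc a) (suc b)
      step {a} {b} (h , e) with b ≟ x
      ... | yes ≡.refl = ⇝zero (h , e) ◅⁺ [ zero⇝x ]
      ... | no b≢x   = [ ≡.trans (cong suc h) (≡.sym (tail-≢ b≢x))
                       , ≡.trans (face′-suc a) (≡.trans e (≡.sym (face′-suc b))) ]

      suc⇝zero : ∀ {a} → TransClosure C a x → TransClosure C′ (suc a) zero
      suc⇝zero ss with splitLast ss
      ... | _ , inj₁ ≡.refl , s = [ ⇝zero s ]
      ... | _ , inj₂ ts   , s = bind⁺ suc step ts ∷ʳ ⇝zero s

    -- In each of its faces the new arc is inserted just before `x`, so a step into `x` becomes a
    -- step into the new arc and another on to `x`.
    subdivide-cyclic : Cyclic M face → Cyclic subdivide face′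
    subdivide-cyclic cyc {zero}  {zero}  e = zero⇝x ◅⁺ suc⇝zero (cyc ≡.refl)
    subdivide-cyclic cyc {zero}  {suc b} e =
      zero⇝x ◅⁺ bind⁺ suc step (cyc (≡.trans (≡.sym face′-zero) (≡.trans e (face′-suc b))))
    subdivide-cyclic cyc {suc a} {zero}  e =
      suc⇝zero (cyc (≡.trans (≡.sym (face′-suc a)) (≡.trans e face′-zero)))
    subdivide-cyclic cyc {suc a} {suc b} e =
      bind⁺ suc step (cyc (≡.trans (≡.sym (face′-suc a)) (≡.trans e (face′-suc b))))

  module _ (valid : Spherical M) (x-plain : excess x ≡ 0) where
    open Spherical valid

    private
      tc : ∀ {a b} → M′.tail a ≡ M′.tail b → M′.col a ≡ M′.col b → a ≡ b
      tc {zero}  {zero}  _ _ = ≡.refl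
      tc {zero}  {suc b} e f with tail-suc (≡.sym e)
      ... | b≢x , q = contradiction (tail-col-injective q (≡.sym f)) b≢x
      tc {suc a} {zero}  e f with tail-suc e
      ... | a≢x , q = contradiction (tail-col-injective q f) a≢x
      tc {suc a} {suc b} e f with updateView shifted x (const zero) b
      ... | untouched b≢x q = cong suc (tail-col-injective (proj₂ (tail-suc (≡.trans e q))) f)
      ... | updated ≡.refl q with updateView shifted x (const zero) a
      ...   | updated ≡.refl _  = ≡.refl
      ...   | untouched a≢x r = contradiction (≡.trans (≡.sym r) (≡.trans e q)) λ ()

      ts : ∀ {a b} → M′.tail a ≡ M′.tail b → M′.symb a ≡ M′.symb b → a ≡ b
      ts {zero}  {zero}  _ _ = ≡.refl
      ts {zero}  {suc b} e f with tail-suc (≡.sym e)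
      ... | b≢x , q = contradiction (tail-sym-injective q (≡.sym f)) b≢x
      ts {suc a} {zero}  e f with tail-suc e
      ... | a≢x , q = contradiction (tail-sym-injective q f) a≢x
      ts {suc a} {suc b} e f with updateView shifted x (const zero) b
      ... | untouched b≢x q = cong suc (tail-sym-injective (proj₂ (tail-suc (≡.trans e q))) f)
      ... | updated ≡.refl q with updateView shifted x (const zero) a
      ...   | updated ≡.refl _  = ≡.refl
      ...   | untouched a≢x r = contradiction (≡.trans (≡.sym r) (≡.trans e q)) λ ()

      excess-old : ∀ {a} → M′.excess (suc a) ≡ 0 → excess a ≡ 0
      excess-old {a} e with updateView excess x (const j) a
      ... | updated ≡.refl _ = x-plain
      ... | untouched _ q  = ≡.trans (≡.sym q) e

      cs : (i ≡ 0 → j ≢ 0) → ∀ {a b} → M′.excess a ≡ 0 → M′.excess b ≡ 0 →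
           M′.col a ≡ M′.col b → M′.symb a ≡ M′.symb b → a ≡ b
      cs h {zero}  {zero}  _ _ _ _ = ≡.refl
      cs h {zero}  {suc b} p q e f with col-sym-injective x-plain (excess-old q) e f
      ... | ≡.refl = contradiction (≡.trans (≡.sym excess-x) q) (h p)
      cs h {suc a} {zero}  p q e f with col-sym-injective (excess-old p) x-plain e f
      ... | ≡.refl = contradiction (≡.trans (≡.sym excess-x) p) (h q)
      cs h {suc a} {suc b} p q e f =
        cong suc (col-sym-injective (excess-old p) (excess-old q) e f)

      rowStep : ∀ {r s s′} → RowStep M r s s′ → RowStep subdivide (suc r) s s′
      rowStep (a , b , ≡.refl , e , f , ≡.refl , ≡.refl) with b ≟ x
      ... | yes ≡.refl = suc a , zero , ≡.refl , cong suc e , f , ≡.refl , ≡.refl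
      ... | no b≢x   = suc a , suc b , ≡.refl , ≡.trans (tail-≢ b≢x) (cong suc e) , f , ≡.refl , ≡.refl

      row : ∀ r {a b} → M′.head a ≡ r → M′.head b ≡ r →
            Star (RowStep subdivide r) (M′.symb a) (M′.symb b)
      row zero    {zero}  {zero}  _ _ = done
      row zero    {suc _} ()
      row zero    {zero}  {suc _} _ ()
      row (suc r) {zero}  ()
      row (suc r) {suc a} {zero}  _ ()
      row (suc r) {suc a} {suc b} e f =
        Star.map rowStep (row-cyclic r (suc-injective e) (suc-injective f))

      old : ∀ a → ∃ λ b → Star (SharesFace subdivide) a (suc b) × Star (SharesFace subdivide) (suc b) a
      old zero    = x , inj₁ ≡.refl ◅ done , inj₁ ≡.refl ◅ done
      old (suc a) = a , done , done

      conn : ∀ a b → Star (SharesFace subdivide) a b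
      conn a b with old a | old b
      ... | a′ , s , _ | b′ , _ , t = s ◅◅ gmap suc (λ e → e) (connected a′ b′) ◅◅ t

      rowOcc : ∀ r → ∃ λ a → M′.tail a ≡ r
      rowOcc zero = suc x , tail-x
      rowOcc (suc r) with row-occurs r
      ... | a , ≡.refl with a ≟ x
      ...   | yes ≡.refl = zero , ≡.refl
      ...   | no a≢x   = suc a , tail-≢ a≢x

    -- The two halves of `x` border the same two faces, so they must not both be plain. One vertex
    -- and one arc more, with the faces unchanged, preserve Euler's formula.
    subdivide-spherical : (i ≡ 0 → j ≢ 0) → Spherical subdivide
    subdivide-spherical h = record
      { tail-col-injective = tc
      ; tail-sym-injective = ts
      ; col-sym-injective  = cs h
      ; col-cyclic         = subdivide-cyclic col M′.col ≡.refl (λ _ → ≡.refl) col-cyclic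
      ; sym-cyclic         = subdivide-cyclic symb M′.symb ≡.refl (λ _ → ≡.refl) sym-cyclic
      ; row-cyclic         = row
      ; connected          = conn
      ; row-occurs         = rowOcc
      ; col-occurs         = λ c → suc (proj₁ (col-occurs c)) , proj₂ (col-occurs c)
      ; sym-occurs         = λ s → suc (proj₁ (sym-occurs s)) , proj₂ (sym-occurs s)
      ; euler              = cong suc euler
      }

  -- Each half of `x` has the new vertex at exactly one end, so `x` itself may have been a loop.
  -- This is how the initial loop disappears.
  subdivide-loopless : (∀ a → a ≢ x → tail a ≢ head a) → Loopless subdivide
  subdivide-loopless h zero    ()
  subdivide-loopless h (suc a) e with tail-suc e
  ... | a≢x , q = h a a≢x q

-- Opening a bundle

-- The arc f, of excess j + 1, becomes two parallel arcs and a reversed arc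
-- between them; one of the parallel arcs keeps excess j.

module Unbundling (M : Map) (f : Fin (Map.nA M)) (j : ℕ) where
  open Map M

  private
    shiftedCol : Vector (Fin (suc nC)) nA
    shiftedCol a = suc (col a)

  unbundle : Map
  unbundle = record
    { nR     = nR
    ; nC     = suc nC
    ; nS     = suc nS
    ; nA     = 2 + nA
    ; tail   = λ { zero → tail f ; (suc zero) → head f ; (suc (suc a)) → tail a }
    ; head   = λ { zero → head f ; (suc zero) → tail f ; (suc (suc a)) → head a }
    ; col    = λ { zero → suc (col f) ; (suc zero) → zero
                 ; (suc (suc a)) → updateAt shiftedCol f (const zero) a }
    ; symb   = λ { zero → zero ; (suc zero) → zero ; (suc (suc a)) → suc (symb a) }
    ; excess = λ { zero → 0 ; (suc zero) → 0 ; (suc (suc a)) → updateAt excess f (const j) a }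
    }

  private
    module M′ = Map unbundle

    pattern forth = zero
    pattern back  = suc zero
    pattern old a = suc (suc a)

  col-f : M′.col (old f) ≡ zero
  col-f = updateAt-updates f shiftedCol

  col-≢ : ∀ {a} → a ≢ f → M′.col (old a) ≡ suc (col a)
  col-≢ {a} = updateAt-minimal a f shiftedCol

  excess-f : M′.excess (old f) ≡ j
  excess-f = updateAt-updates f excess

  excess-≢ : ∀ {a} → a ≢ f → M′.excess (old a) ≡ excess a
  excess-≢ {a} = updateAt-minimal a f excess

  private
    col-zero : ∀ {a} → M′.col (old a) ≡ zero → a ≡ f
    col-zero {a} e with updateView shiftedCol f (const zero) a
    ... | updated a≡f _ = a≡f
    ... | untouched _ q = contradiction (≡.trans (≡.sym q) e) λ ()

    col-suc : ∀ {a c} → M′.col (old a) ≡ suc c → a ≢ f × col a ≡ c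
    col-suc {a} e with updateView shiftedCol f (const zero) a
    ... | updated ≡.refl q  = contradiction (≡.trans (≡.sym q) e) λ ()
    ... | untouched a≢f q = a≢f , suc-injective (≡.trans (≡.sym q) e)

  module _ {X Y : Set} (face : Fin nA → X) (face′ : Fin (2 + nA) → Y)
           (new : Y) (lift : X → Y) (lift-injective : ∀ {x y} → lift x ≡ lift y → x ≡ y)
           (e : Fin nA → Fin (2 + nA))
           (tail-e : ∀ a → M′.tail (e a) ≡ tail a) (head-e : ∀ a → M′.head (e a) ≡ head a)
           (face-e : ∀ a → face′ (e a) ≡ lift (face a)) (lift≢new : ∀ {x} → lift x ≢ new)
           (m n : Fin (2 + nA)) (face-m : face′ m ≡ new) (face-n : face′ n ≡ new)
           (m⇝n : M′.head m ≡ M′.tail n) (n⇝m : M′.head n ≡ M′.tail m)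
           (cover : ∀ a → (∃ λ b → a ≡ e b) ⊎ a ≡ m ⊎ a ≡ n)
           where
    private
      C′ = Consecutive unbundle face′

      step : ∀ {a b} → Consecutive M face a b → TransClosure C′ (e a) (e b)
      step (h , q) = [ ≡.trans (head-e _) (≡.trans h (≡.sym (tail-e _)))
                     , ≡.trans (face-e _) (≡.trans (cong lift q) (≡.sym (face-e _))) ]

      mn : C′ m n
      mn = m⇝n , ≡.trans face-m (≡.sym face-n)

      nm : C′ n m
      nm = n⇝m , ≡.trans face-n (≡.sym face-m)

      clash : ∀ {a b} → face′ (e a) ≡ face′ b → face′ b ≢ new
      clash q r = lift≢new (≡.trans (≡.sym (face-e _)) (≡.trans q r))

    -- Serves columns and symbols alike: `e` carries the old faces, and the new face is a digon
    -- whose arcs `m` and `n` follow each other.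
    unbundle-cyclic : Cyclic M face → Cyclic unbundle face′
    unbundle-cyclic cyc {a} {b} q with cover a | cover b
    ... | inj₁ (a , ≡.refl)  | inj₁ (b , ≡.refl)  =
      bind⁺ e step (cyc (lift-injective (≡.trans (≡.sym (face-e a)) (≡.trans q (face-e b)))))
    ... | inj₁ (_ , ≡.refl)  | inj₂ (inj₁ ≡.refl) = contradiction face-m (clash q)
    ... | inj₁ (_ , ≡.refl)  | inj₂ (inj₂ ≡.refl) = contradiction face-n (clash q)
    ... | inj₂ (inj₁ ≡.refl) | inj₁ (_ , ≡.refl)  = contradiction face-m (clash (≡.sym q))
    ... | inj₂ (inj₂ ≡.refl) | inj₁ (_ , ≡.refl)  = contradiction face-n (clash (≡.sym q))
    ... | inj₂ (inj₁ ≡.refl) | inj₂ (inj₁ ≡.refl) = mn ◅⁺ [ nm ]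
    ... | inj₂ (inj₁ ≡.refl) | inj₂ (inj₂ ≡.refl) = [ mn ]
    ... | inj₂ (inj₂ ≡.refl) | inj₂ (inj₁ ≡.refl) = [ nm ]
    ... | inj₂ (inj₂ ≡.refl) | inj₂ (inj₂ ≡.refl) = nm ◅⁺ [ mn ]

  module _ (valid : Spherical M) (f-proper : tail f ≢ head f) where
    open Spherical valid

    private
      -- In the old column of f the first copy takes the place of f.
      e : Fin nA → Fin (2 + nA)
      e a with a ≟ f
      ... | yes _ = forth
      ... | no _  = old a

      e-f : ∀ {a} → a ≡ f → e a ≡ forth
      e-f {a} a≡f with a ≟ f
      ... | yes _  = ≡.refl
      ... | no a≢f = contradiction a≡f a≢f

      e-≢ : ∀ {a} → a ≢ f → e a ≡ old a
      e-≢ {a} a≢f with a ≟ f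
      ... | yes a≡f = contradiction a≡f a≢f
      ... | no _    = ≡.refl

      tail-e : ∀ a → M′.tail (e a) ≡ tail a
      tail-e a with a ≟ f
      ... | yes ≡.refl = ≡.refl
      ... | no _     = ≡.refl

      head-e : ∀ a → M′.head (e a) ≡ head a
      head-e a with a ≟ f
      ... | yes ≡.refl = ≡.refl
      ... | no _     = ≡.refl

      col-e : ∀ a → M′.col (e a) ≡ suc (col a)
      col-e a with a ≟ f
      ... | yes ≡.refl = ≡.refl
      ... | no a≢f   = col-≢ a≢f

      cover-e : ∀ a → (∃ λ b → a ≡ e b) ⊎ a ≡ back ⊎ a ≡ old f
      cover-e forth   = inj₁ (f , ≡.sym (e-f ≡.refl))
      cover-e back    = inj₂ (inj₁ ≡.refl)
      cover-e (old a) with a ≟ f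
      ... | yes ≡.refl = inj₂ (inj₂ ≡.refl)
      ... | no a≢f   = inj₁ (a , ≡.sym (e-≢ a≢f))

      cover-old : ∀ (a : Fin (2 + nA)) → (∃ λ (b : Fin nA) → a ≡ old b) ⊎ a ≡ forth ⊎ a ≡ back
      cover-old forth   = inj₂ (inj₁ ≡.refl)
      cover-old back    = inj₂ (inj₂ ≡.refl)
      cover-old (old a) = inj₁ (a , ≡.refl)

      tc : ∀ {a b} → M′.tail a ≡ M′.tail b → M′.col a ≡ M′.col b → a ≡ b
      tc {forth} {forth} _ _ = ≡.refl
      tc {forth} {back}  _ ()
      tc {back}  {forth} _ ()
      tc {back}  {back}  _ _ = ≡.refl
      tc {forth} {old b} p q with col-suc (≡.sym q)
      ... | b≢f , r = contradiction (tail-col-injective (≡.sym p) r) b≢f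
      tc {old a} {forth} p q with col-suc q
      ... | a≢f , r = contradiction (tail-col-injective p r) a≢f
      tc {back}  {old b} p q with col-zero (≡.sym q)
      ... | ≡.refl = contradiction (≡.sym p) f-proper
      tc {old a} {back}  p q with col-zero q
      ... | ≡.refl = contradiction p f-proper
      tc {old a} {old b} p q with updateView shiftedCol f (const zero) b
      ... | updated ≡.refl r  = cong (λ x → old x) (col-zero (≡.trans q r))
      ... | untouched b≢f r =
        cong (λ x → old x) (tail-col-injective p (proj₂ (col-suc (≡.trans q r))))

      ts : ∀ {a b} → M′.tail a ≡ M′.tail b → M′.symb a ≡ M′.symb b → a ≡ b
      ts {forth} {forth} _ _ = ≡.refl
      ts {forth} {back}  p _ = contradiction p f-proper
      ts {back}  {forth} p _ = contradiction (≡.sym p) f-proper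
      ts {back}  {back}  _ _ = ≡.refl
      ts {forth} {old b} _ ()
      ts {back}  {old b} _ ()
      ts {old a} {forth} _ ()
      ts {old a} {back}  _ ()
      ts {old a} {old b} p q = cong (λ x → old x) (tail-sym-injective p (suc-injective q))

      cs : ∀ {a b} → M′.excess a ≡ 0 → M′.excess b ≡ 0 →
           M′.col a ≡ M′.col b → M′.symb a ≡ M′.symb b → a ≡ b
      cs {forth} {forth} _ _ _ _ = ≡.refl
      cs {forth} {back}  _ _ () _
      cs {back}  {forth} _ _ () _
      cs {back}  {back}  _ _ _ _ = ≡.refl
      cs {forth} {old b} _ _ _ ()
      cs {back}  {old b} _ _ _ ()
      cs {old a} {forth} _ _ _ ()
      cs {old a} {back}  _ _ _ ()
      cs {old a} {old b} m n p q with updateView shiftedCol f (const zero) b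
      ... | updated ≡.refl r  = cong (λ x → old x) (col-zero (≡.trans p r))
      ... | untouched b≢f r with col-suc (≡.trans p r)
      ...   | a≢f , s = cong (λ x → old x)
        (col-sym-injective (≡.trans (≡.sym (excess-≢ a≢f)) m) (≡.trans (≡.sym (excess-≢ b≢f)) n)
          s (suc-injective q))

      -- At either end of `f` the new symbol comes between two old ones, so a step through `f`
      -- becomes two steps by way of `zero`.
      lift-step : ∀ {r s s′} → RowStep M r s s′ → Star (RowStep unbundle r) (suc s) (suc s′)
      lift-step (a , b , p , q , m , ≡.refl , ≡.refl) with a ≟ f | b ≟ f
      ... | yes ≡.refl | yes ≡.refl = contradiction (≡.trans q (≡.sym p)) f-proper
      ... | no a≢f   | no b≢f   =
        (old a , old b , p , q , ≡.trans (col-≢ a≢f) (≡.trans (cong suc m) (≡.sym (col-≢ b≢f))) ,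
          ≡.refl , ≡.refl) ◅ done
      ... | no a≢f   | yes ≡.refl =
        (old a , forth , p , q , ≡.trans (col-≢ a≢f) (cong suc m) , ≡.refl , ≡.refl) ◅
        (back , old f , q , q , ≡.sym col-f , ≡.refl , ≡.refl) ◅ done
      ... | yes ≡.refl | no b≢f   =
        (old f , back , p , p , col-f , ≡.refl , ≡.refl) ◅
        (forth , old b , p , q , ≡.trans (cong suc m) (≡.sym (col-≢ b≢f)) , ≡.refl , ≡.refl) ◅ done

      lift-star : ∀ {r s s′} → Star (RowStep M r) s s′ → Star (RowStep unbundle r) (suc s) (suc s′)
      lift-star = kleisliStar suc lift-step

      out-f : ∃ λ a → Consecutive M col f a
      out-f = firstStep (col-cyclic ≡.refl)

      in-f : ∃ λ a → Consecutive M col a f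
      in-f with splitLast (col-cyclic {f} {f} ≡.refl)
      ... | a , _ , s = a , s

      in-f′ : ∃ λ a → Consecutive M symb a f
      in-f′ with splitLast (sym-cyclic {f} {f} ≡.refl)
      ... | a , _ , s = a , s

      to-zero : ∀ {r a} → (head f ≡ r ⊎ tail f ≡ r) → head a ≡ r →
                Star (RowStep unbundle r) (suc (symb a)) zero
      to-zero (inj₁ ≡.refl) p =
        lift-star (row-cyclic _ p ≡.refl) ◅◅ (old f , back , ≡.refl , ≡.refl , col-f , ≡.refl , ≡.refl) ◅ done
      to-zero (inj₂ ≡.refl) p with in-f
      ... | d , h , c with d ≟ f
      ...   | yes ≡.refl = contradiction (≡.sym h) f-proper
      ...   | no d≢f   =
        lift-star (row-cyclic _ p h) ◅◅
        (old d , forth , h , ≡.refl , ≡.trans (col-≢ d≢f) (cong suc c) , ≡.refl , ≡.refl) ◅ done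

      from-zero : ∀ {r a} → (head f ≡ r ⊎ tail f ≡ r) → head a ≡ r →
                  Star (RowStep unbundle r) zero (suc (symb a))
      from-zero (inj₁ ≡.refl) p with out-f
      ... | d , h , c with d ≟ f
      ...   | yes ≡.refl = contradiction (≡.sym h) f-proper
      -- `row-cyclic` speaks of symbols of arcs that arrive at the row, so the symbol of the
      -- departing arc `d` is attributed to its predecessor `g`.
      ...   | no d≢f   with splitLast (sym-cyclic {d} {d} ≡.refl)
      ...     | g , _ , h′ , t =
        (forth , old d , ≡.refl , ≡.sym h , ≡.trans (cong suc c) (≡.sym (col-≢ d≢f)) ,
          ≡.refl , cong suc (≡.sym t)) ◅
        lift-star (row-cyclic _ {g} (≡.trans h′ (≡.sym h)) p)
      from-zero (inj₂ ≡.refl) p with in-f′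
      ... | d , h , s =
        (back , old f , ≡.refl , ≡.refl , ≡.sym col-f , ≡.refl , cong suc (≡.sym s)) ◅
        lift-star (row-cyclic _ {d} h p)

      row : ∀ r {a b} → M′.head a ≡ r → M′.head b ≡ r →
            Star (RowStep unbundle r) (M′.symb a) (M′.symb b)
      row r {forth} {forth} _ _ = done
      row r {forth} {back}  _ _ = done
      row r {back}  {forth} _ _ = done
      row r {back}  {back}  _ _ = done
      row r {forth} {old b} p q = from-zero (inj₁ p) q
      row r {back}  {old b} p q = from-zero (inj₂ p) q
      row r {old a} {forth} p q = to-zero (inj₁ q) p
      row r {old a} {back}  p q = to-zero (inj₂ q) p
      row r {old a} {old b} p q = lift-star (row-cyclic r p q)

      f~back : SharesFace unbundle (old f) back
      f~back = inj₁ col-f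

      back~f : SharesFace unbundle back (old f)
      back~f = inj₁ (≡.sym col-f)

      forth~back : SharesFace unbundle forth back
      forth~back = inj₂ ≡.refl

      back~forth : SharesFace unbundle back forth
      back~forth = inj₂ ≡.refl

      old⇝e : ∀ a → Star (SharesFace unbundle) (old a) (e a)
      old⇝e a with a ≟ f
      ... | yes ≡.refl = _◅_ {j = back} f~back (back~forth ◅ done)
      ... | no _     = done

      e⇝old : ∀ a → Star (SharesFace unbundle) (e a) (old a)
      e⇝old a with a ≟ f
      ... | yes ≡.refl = _◅_ {j = back} forth~back (back~f ◅ done)
      ... | no _     = done

      share : ∀ {a b} → SharesFace M a b → Star (SharesFace unbundle) (old a) (old b)
      share {a} {b} (inj₁ p) =
        old⇝e a ◅◅ inj₁ (≡.trans (col-e a) (≡.trans (cong suc p) (≡.sym (col-e b)))) ◅ e⇝old b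
      share (inj₂ p) = inj₂ (cong suc p) ◅ done

      nearby : ∀ a → ∃ λ b → Star (SharesFace unbundle) a (old b) × Star (SharesFace unbundle) (old b) a
      nearby forth   = f , subst (λ x → Star _ x (old f)) (e-f ≡.refl) (e⇝old f)
                         , subst (λ x → Star _ (old f) x) (e-f ≡.refl) (old⇝e f)
      nearby back    = f , back~f ◅ done , f~back ◅ done
      nearby (old a) = a , done , done

      conn : ∀ a b → Star (SharesFace unbundle) a b
      conn a b with nearby a | nearby b
      ... | a′ , s , _ | b′ , _ , t = s ◅◅ kleisliStar (λ x → old x) share (connected a′ b′) ◅◅ t

      colOcc : ∀ c → ∃ λ a → M′.col a ≡ c
      colOcc zero = back , ≡.refl
      colOcc (suc c) with col-occurs c
      ... | a , ≡.refl = e a , col-e a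

      symOcc : ∀ s → ∃ λ a → M′.symb a ≡ s
      symOcc zero = back , ≡.refl
      symOcc (suc s) with sym-occurs s
      ... | a , ≡.refl = old a , ≡.refl

    -- Two arcs, one column and one symbol more preserve Euler's formula. If `f` were a loop,
    -- `forth` and `back` would leave the same vertex along the same symbol, against
    -- `tail-sym-injective`.
    unbundle-spherical : Spherical unbundle
    unbundle-spherical = record
      { tail-col-injective = tc
      ; tail-sym-injective = ts
      ; col-sym-injective  = cs
      ; col-cyclic         = unbundle-cyclic col M′.col zero suc suc-injective e tail-e head-e col-e (λ ())
                               back (old f) ≡.refl col-f ≡.refl ≡.refl cover-e col-cyclic
      ; sym-cyclic         = unbundle-cyclic symb M′.symb zero suc suc-injective (λ a → old a)
                               (λ _ → ≡.refl) (λ _ → ≡.refl) (λ _ → ≡.refl) (λ ())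
                               forth back ≡.refl ≡.refl ≡.refl ≡.refl cover-old sym-cyclic
      ; row-cyclic         = row
      ; connected          = conn
      ; row-occurs         = λ r → old (proj₁ (row-occurs r)) , proj₂ (row-occurs r)
      ; col-occurs         = colOcc
      ; sym-occurs         = symOcc
      ; euler              = ≡.trans (cong (_+ suc nS) (ℕ.+-suc nR nC))
                               (cong suc (≡.trans (ℕ.+-suc (nR + nC) nS) (cong suc euler)))
      }

  unbundle-loopless : Loopless M → Loopless unbundle
  unbundle-loopless h forth   = h f
  unbundle-loopless h back    = h f ∘ ≡.sym
  unbundle-loopless h (old a) = h a

open Subdivision public using (subdivide; subdivide-spherical; subdivide-loopless)
open Unbundling public using (unbundle; unbundle-spherical; unbundle-loopless)

singleLoop : Map
singleLoop = record
  { nR = 1 ; nC = 1 ; nS = 1 ; nA = 1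
  ; tail = λ _ → zero ; head = λ _ → zero ; col = λ _ → zero ; symb = λ _ → zero
  ; excess = λ _ → 0
  }

singleLoop-spherical : Spherical singleLoop
singleLoop-spherical = record
  { tail-col-injective = λ _ _ → unique
  ; tail-sym-injective = λ _ _ → unique
  ; col-sym-injective  = λ _ _ _ _ → unique
  ; col-cyclic         = λ _ → [ ≡.refl , ≡.refl ]
  ; sym-cyclic         = λ _ → [ ≡.refl , ≡.refl ]
  ; row-cyclic         = λ _ _ _ → done
  ; connected          = λ _ _ → inj₁ ≡.refl ◅ done
  ; row-occurs         = λ { zero → zero , ≡.refl }
  ; col-occurs         = λ { zero → zero , ≡.refl }
  ; sym-occurs         = λ { zero → zero , ≡.refl }
  ; euler              = ≡.refl
  }
  where
  unique : {a b : Fin 1} → a ≡ b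
  unique {zero} {zero} = ≡.refl

-- From maps to bitrades

injective⇒surjective : ∀ {n} (f : Fin n → Fin n) → (∀ {i j} → f i ≡ f j → i ≡ j) →
                       ∀ y → ∃ λ x → f x ≡ y
injective⇒surjective {suc n} f inj y with any? (λ x → f x ≟ y)
... | yes found = found
... | no ∄x     = contradiction (injective⇒≤ {f = g} g-injective) ℕ.1+n≰n
  where
  y≢f : ∀ x → y ≢ f x
  y≢f x e = ∄x (x , ≡.sym e)

  g : Fin (suc n) → Fin n
  g x = punchOut (y≢f x)

  g-injective : ∀ {i j} → g i ≡ g j → i ≡ j
  g-injective e = inj (punchOut-injective (y≢f _) (y≢f _) e)

module _ (M : Map) where
  open Map M

  -- Choosing a predecessor along the face is an injective map on a finite set, hence a bijection,
  -- so successors exist too. Arcs with the same head and face have successors with the same tail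
  -- and face, and these coincide.
  head-injective : ∀ {X : Set} {face : Fin nA → X} →
    (∀ {a b} → tail a ≡ tail b → face a ≡ face b → a ≡ b) → Cyclic M face →
    ∀ {a b} → head a ≡ head b → face a ≡ face b → a ≡ b
  head-injective {face = face} inj cyc {a} {b} p q =
    ≡.trans (≡.sym (prev-next a)) (≡.trans (cong prev (inj (tails a b p) (faces a b q))) (prev-next b))
    where
    prev⇝ : ∀ a → ∃ λ b → Consecutive M face b a
    prev⇝ a with splitLast (cyc {a} {a} ≡.refl)
    ... | b , _ , s = b , s

    prev : Fin nA → Fin nA
    prev a = proj₁ (prev⇝ a)

    head-prev : ∀ a → head (prev a) ≡ tail a
    head-prev a = proj₁ (proj₂ (prev⇝ a))

    face-prev : ∀ a → face (prev a) ≡ face a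
    face-prev a = proj₂ (proj₂ (prev⇝ a))

    prev-injective : ∀ {a b} → prev a ≡ prev b → a ≡ b
    prev-injective {a} {b} e =
      inj (≡.trans (≡.sym (head-prev a)) (≡.trans (cong head e) (head-prev b)))
          (≡.trans (≡.sym (face-prev a)) (≡.trans (cong face e) (face-prev b)))

    next : Fin nA → Fin nA
    next a = proj₁ (injective⇒surjective prev prev-injective a)

    prev-next : ∀ a → prev (next a) ≡ a
    prev-next a = proj₂ (injective⇒surjective prev prev-injective a)

    tails : ∀ a b → head a ≡ head b → tail (next a) ≡ tail (next b)
    tails a b p = ≡.trans (≡.sym (head-prev _)) (≡.trans (cong head (prev-next a))
      (≡.trans p (≡.trans (cong head (≡.sym (prev-next b))) (head-prev _))))

    faces : ∀ a b → face a ≡ face b → face (next a) ≡ face (next b)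
    faces a b q = ≡.trans (≡.sym (face-prev _)) (≡.trans (cong face (prev-next a))
      (≡.trans q (≡.trans (cong face (≡.sym (prev-next b))) (face-prev _))))

-- Counting with indicators

indicator : Bool → ℕ
indicator b = if b then 1 else 0

indicator-false : ∀ {b} → ¬ T b → indicator b ≡ 0
indicator-false {false} _ = ≡.refl
indicator-false {true}  h = contradiction _ h

indicator-true : ∀ {b} → T b → indicator b ≡ 1
indicator-true {true} _ = ≡.refl

sum-zero : ∀ {n} (f : Fin n → ℕ) → (∀ i → f i ≡ 0) → sum f ≡ 0
sum-zero {n} f h = ≡.trans (sum-cong-≗ h) (sum-replicate-zero n)

sum-single : ∀ {n} (f : Fin n → ℕ) i → (∀ j → j ≢ i → f j ≡ 0) → sum f ≡ f i
sum-single f zero    h =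
  ≡.trans (cong (f zero +_) (sum-zero (f ∘ suc) λ j → h (suc j) λ ())) (ℕ.+-identityʳ _)
sum-single f (suc i) h =
  ≡.trans (cong (_+ sum (f ∘ suc)) (h zero λ ()))
        (sum-single (f ∘ suc) i λ j j≢i → h (suc j) (j≢i ∘ suc-injective))

sum-ones : ∀ {n} (f : Fin n → ℕ) → (∀ i → f i ≡ 1) → sum f ≡ n
sum-ones {zero}  f h = ≡.refl
sum-ones {suc n} f h = cong₂ _+_ (h zero) (sum-ones (f ∘ suc) (h ∘ suc))

indicator-does : ∀ {A : Set} (A? : Dec A) → A → indicator (does A?) ≡ 1
indicator-does (yes _) _ = ≡.refl
indicator-does (no ¬a) a = contradiction a ¬a

indicator-¬does : ∀ {A : Set} (A? : Dec A) → ¬ A → indicator (does A?) ≡ 0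
indicator-¬does (yes a) ¬a = contradiction a ¬a
indicator-¬does (no _)  _  = ≡.refl

sum-fibres : ∀ {m n} (f : Fin m → Fin n) (P : Fin m → ℕ) →
             sum (λ y → sum λ x → P x * indicator (does (f x ≟ y))) ≡ sum P
sum-fibres f P = ≡.trans (∑-comm λ y x → P x * indicator (does (f x ≟ y))) (sum-cong-≗ λ x →
  ≡.trans (sum-single _ (f x) λ y y≢fx →
           ≡.trans (cong (P x *_) (indicator-¬does (f x ≟ y) (y≢fx ∘ ≡.sym))) (ℕ.*-zeroʳ (P x)))
        (≡.trans (cong (P x *_) (indicator-does (f x ≟ f x) ≡.refl)) (ℕ.*-identityʳ (P x))))

-- As `f` and `g` together determine `a`, each cell's indicator is a sum over `a` of products of two
-- indicators. Exchanging the sums then counts every `a` once.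
count-pairs : ∀ {m n N} (f : Fin N → Fin m) (g : Fin N → Fin n) (Q : Fin m → Fin n → Bool) →
  (∀ {a b} → f a ≡ f b → g a ≡ g b → a ≡ b) →
  (∀ x y → T (Q x y) → ∃ λ a → f a ≡ x × g a ≡ y) → (∀ a → T (Q (f a) (g a))) →
  sum (λ x → sum λ y → indicator (Q x y)) ≡ N
count-pairs {N = N} f g Q inj sound complete =
  ≡.trans (sum-cong-≗ λ x → ≡.trans (sum-cong-≗ (cell x)) (sum-fibres g (λ a → indicator (does (f a ≟ x)))))
    (≡.trans (sum-cong-≗ λ x → sum-cong-≗ λ a → ≡.sym (ℕ.*-identityˡ (indicator (does (f a ≟ x)))))
      (≡.trans (sum-fibres f (const 1)) (sum-ones {N} _ λ _ → ≡.refl)))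
  where
  cell : ∀ x y → indicator (Q x y) ≡ sum λ a → indicator (does (f a ≟ x)) * indicator (does (g a ≟ y))
  cell x y with any? (λ a → ≡-dec _≟_ _≟_ (f a , g a) (x , y))
  ... | yes (a , ≡.refl) = ≡.trans (indicator-true (complete a)) (≡.sym
    (≡.trans (sum-single _ a off)
      (≡.trans (cong (_* indicator (does (g a ≟ g a))) (indicator-does (f a ≟ f a) ≡.refl))
        (≡.trans (ℕ.*-identityˡ _) (indicator-does (g a ≟ g a) ≡.refl)))))
    where
    off : ∀ b → b ≢ a → indicator (does (f b ≟ f a)) * indicator (does (g b ≟ g a)) ≡ 0
    off b b≢a with f b ≟ f a
    ... | no _  = ≡.refl
    ... | yes p = ≡.trans (ℕ.+-identityʳ _) (indicator-¬does (g b ≟ g a) λ q → b≢a (inj p q))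
  ... | no ∄a = ≡.trans (indicator-false λ t → ∄a (let a , p , q = sound x y t in a , cong₂ _,_ p q))
    (≡.sym (sum-zero _ off))
    where
    off : ∀ b → indicator (does (f b ≟ x)) * indicator (does (g b ≟ y)) ≡ 0
    off b with f b ≟ x
    ... | no _  = ≡.refl
    ... | yes p = ≡.trans (ℕ.+-identityʳ _) (indicator-¬does (g b ≟ y) λ q → ∄a (b , cong₂ _,_ p q))

any-sound : ∀ {n} (f : Vector Bool n) → T (any f) → ∃ λ i → T (f i)
any-sound {suc n} f t with f zero in e
... | true  = zero , subst T (≡.sym e) _
... | false = let i , u = any-sound (f ∘ suc) t in suc i , u

any-complete : ∀ {n} (f : Vector Bool n) i → T (f i) → T (any f)
any-complete f zero    t = Equivalence.from (T-∨ {f zero}) (inj₁ t)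
any-complete f (suc i) t = Equivalence.from (T-∨ {f zero}) (inj₂ (any-complete (f ∘ suc) i t))

sum-any : ∀ {n} (f : Vector Bool n) → (∀ {i j} → T (f i) → T (f j) → i ≡ j) →
          sum (λ i → indicator (f i)) ≡ indicator (any f)
sum-any {zero}  f _ = ≡.refl
sum-any {suc n} f h with f zero in e
... | true  = cong suc (sum-zero _ λ i → indicator-false λ t →
    contradiction (h {zero} {suc i} (subst T (≡.sym e) _) t) λ ())
... | false = sum-any (f ∘ suc) λ t u → suc-injective (h t u)

-- The triangles at one end of every arc

module _ {nR nC nS nA : ℕ} (end : Fin nA → Fin nR) (col : Fin nA → Fin nC) (symb : Fin nA → Fin nS) where

  private
    triangle? : ∀ t → Dec (∃ λ a → (end a , col a , symb a) ≡ t)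
    triangle? t = any? λ a → ≡-dec _≟_ (≡-dec _≟_ _≟_) (end a , col a , symb a) t

  triangles : TripleSet nR nC nS
  triangles t = isYes (triangle? t)

  triangles-sound : ∀ {r c s} → T (triangles (r , c , s)) → ∃ λ a → end a ≡ r × col a ≡ c × symb a ≡ s
  triangles-sound {r} {c} {s} t with toWitness {a? = triangle? (r , c , s)} t
  ... | a , e = a , cong proj₁ e , cong (proj₁ ∘ proj₂) e , cong (proj₂ ∘ proj₂) e

  triangles-complete : ∀ a → T (triangles (end a , col a , symb a))
  triangles-complete a = fromWitness {a? = triangle? _} (a , ≡.refl)

  at : ∀ {r c s} a → end a ≡ r → col a ≡ c → symb a ≡ s → T (triangles (r , c , s))
  at a ≡.refl ≡.refl ≡.refl = triangles-complete a

  module _ (ec : ∀ {a b} → end a ≡ end b → col a ≡ col b → a ≡ b)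
           (es : ∀ {a b} → end a ≡ end b → symb a ≡ symb b → a ≡ b)
           (cs : ∀ {a b} → col a ≡ col b → symb a ≡ symb b → a ≡ b) where

    triangles-PLS : IsPartialLatinSquare triangles
    triangles-PLS {r , c , s} {r′ , c′ , s′} t u t≢u agree with triangles-sound t | triangles-sound u
    triangles-PLS t u t≢u (inj₁ (p , q))
      | a , ≡.refl , ≡.refl , ≡.refl | b , ≡.refl , ≡.refl , ≡.refl with ec p q
    ... | ≡.refl = t≢u ≡.refl
    triangles-PLS t u t≢u (inj₂ (inj₁ (p , q)))
      | a , ≡.refl , ≡.refl , ≡.refl | b , ≡.refl , ≡.refl , ≡.refl with es p q
    ... | ≡.refl = t≢u ≡.refl
    triangles-PLS t u t≢u (inj₂ (inj₂ (p , q)))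
      | a , ≡.refl , ≡.refl , ≡.refl | b , ≡.refl , ≡.refl , ≡.refl with cs p q
    ... | ≡.refl = t≢u ≡.refl

    private
      s-unique : ∀ r c {s s′} → T (triangles (r , c , s)) → T (triangles (r , c , s′)) → s ≡ s′
      s-unique r c t u with triangles-sound t | triangles-sound u
      ... | a , p , q , ≡.refl | b , p′ , q′ , ≡.refl =
        cong symb (ec (≡.trans p (≡.sym p′)) (≡.trans q (≡.sym q′)))

      count-end-col : sum (λ r → sum λ c → indicator (any λ s → triangles (r , c , s))) ≡ nA
      count-end-col = count-pairs end col _ ec
        (λ r c t → let s , u = any-sound (λ s → triangles (r , c , s)) t
                       a , p , q , _ = triangles-sound {r} {c} {s} u
                   in a , p , q)
        (λ a → any-complete (λ s → triangles (end a , col a , s)) (symb a) (triangles-complete a))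

    size-triangles : size triangles ≡ nA
    size-triangles = ≡.trans
      (sum-cong-≗ λ r → sum-cong-≗ λ c → sum-any (λ s → triangles (r , c , s)) (s-unique r c))
      count-end-col

    edges-triangles : edges triangles ≡ nA + nA + nA
    edges-triangles = cong₂ _+_ (cong₂ _+_ count-end-col
      (count-pairs end symb _ es
        (λ r s t → let c , u = any-sound (λ c → triangles (r , c , s)) t
                       a , p , _ , q = triangles-sound {r} {c} {s} u
                   in a , p , q)
        (λ a → any-complete (λ c → triangles (end a , c , symb a)) (col a) (triangles-complete a))))
      (count-pairs col symb _ cs
        (λ c s t → let r , u = any-sound (λ r → triangles (r , c , s)) t
                       a , _ , p , q = triangles-sound {r} {c} {s} u
                   in a , p , q)
        (λ a → any-complete (λ r → triangles (r , col a , symb a)) (end a) (triangles-complete a)))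

module _ {nR nC nS nA : ℕ} (end end′ : Fin nA → Fin nR) (col : Fin nA → Fin nC) (symb : Fin nA → Fin nS)
         (apart : ∀ a → end′ a ≢ end a)
         (ec : ∀ {a b} → end′ a ≡ end′ b → col a ≡ col b → a ≡ b)
         (es : ∀ {a b} → end′ a ≡ end′ b → symb a ≡ symb b → a ≡ b)
         (cs : ∀ {a b} → col a ≡ col b → symb a ≡ symb b → a ≡ b)
         (alongCol : ∀ a → ∃ λ b → end′ b ≡ end a × col b ≡ col a)
         (alongSym : ∀ a → ∃ λ b → end′ b ≡ end a × symb b ≡ symb a)
         where

  private
    turn : ∀ {a b} → end′ b ≡ end a → a ≢ b
    turn p ≡.refl = apart _ p

  -- Replacing the row leads to the triangle at the other end of the same arc; replacing the column
  -- or the symbol leads to a neighbouring arc on the face that is kept. With the ends as parameters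
  -- this serves white against black and black against white.
  triangles-mates : HasUniqueMates (triangles end col symb) (triangles end′ col symb)
  triangles-mates t with triangles-sound end col symb t
  ... | a , ≡.refl , ≡.refl , ≡.refl with alongSym a | alongCol a
  ...   | b , pb , qb | d , pd , qd =
    (end′ a , (apart a , at end′ col symb a ≡.refl ≡.refl ≡.refl) ,
      λ (_ , u) → let x , p , q , r = triangles-sound end′ col symb u in
                  ≡.trans (cong end′ (≡.sym (cs q r))) p) ,
    (col b , ((λ e → turn pb (cs (≡.sym e) (≡.sym qb))) , at end′ col symb b pb ≡.refl qb) ,
      λ (_ , u) → let x , p , q , r = triangles-sound end′ col symb u in
                  ≡.trans (cong col (es (≡.trans pb (≡.sym p)) (≡.trans qb (≡.sym r)))) q) ,
    (symb d , ((λ e → turn pd (cs (≡.sym qd) (≡.sym e))) , at end′ col symb d pd qd ≡.refl) ,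
      λ (_ , u) → let x , p , q , r = triangles-sound end′ col symb u in
                  ≡.trans (cong symb (ec (≡.trans pd (≡.sym p)) (≡.trans qd (≡.sym q)))) r)

module _ (M : Map) (valid : Spherical M) (plain : ∀ a → Map.excess M a ≡ 0) (loopless : Loopless M) where
  open Map M
  open Spherical valid

  private
    W B : TripleSet nR nC nS
    W = triangles head col symb
    B = triangles tail col symb

    cs : ∀ {a b} → col a ≡ col b → symb a ≡ symb b → a ≡ b
    cs = col-sym-injective (plain _) (plain _)

    hc : ∀ {a b} → head a ≡ head b → col a ≡ col b → a ≡ b
    hc = head-injective M tail-col-injective col-cyclic

    hs : ∀ {a b} → head a ≡ head b → symb a ≡ symb b → a ≡ b
    hs = head-injective M tail-sym-injective sym-cyclic

    next : ∀ {X : Set} {face : Fin nA → X} → Cyclic M face → ∀ a → ∃ λ b → tail b ≡ head a × face b ≡ face a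
    next cyc a with firstStep (cyc {a} {a} ≡.refl)
    ... | b , h , e = b , ≡.sym h , ≡.sym e

    prev : ∀ {X : Set} {face : Fin nA → X} → Cyclic M face → ∀ a → ∃ λ b → head b ≡ tail a × face b ≡ face a
    prev cyc a with splitLast (cyc {a} {a} ≡.refl)
    ... | b , _ , s = b , s

    W-mates : HasUniqueMates W B
    W-mates = triangles-mates head tail col symb loopless tail-col-injective tail-sym-injective cs
      (next col-cyclic) (next sym-cyclic)

    B-mates : HasUniqueMates B W
    B-mates = triangles-mates tail head col symb (λ a → loopless a ∘ ≡.sym) hc hs cs
      (prev col-cyclic) (prev sym-cyclic)

    exhaustive : (end : Fin nA → Fin nR) → (∀ r → ∃ λ a → end a ≡ r) → Exhaustive (triangles end col symb)
    exhaustive end occurs = record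
      { row-occurs    = λ r → let a , p = occurs r in
                        col a , symb a , at end col symb a p ≡.refl ≡.refl
      ; column-occurs = λ c → let a , p = col-occurs c in
                        end a , symb a , at end col symb a ≡.refl p ≡.refl
      ; symbol-occurs = λ s → let a , p = sym-occurs s in
                        end a , col a , at end col symb a ≡.refl ≡.refl p
      }

    row-occurs′ : ∀ r → ∃ λ a → head a ≡ r
    row-occurs′ r with row-occurs r
    ... | a , ≡.refl = let b , p , _ = prev col-cyclic a in b , p

  bitrade : Fin nA → LatinBitrade
  bitrade a₀ = record
    { W = W
    ; B = B
    ; isLatinBitrade = record
      { W-nonEmpty = _ , triangles-complete head col symb a₀
      ; B-nonEmpty = _ , triangles-complete tail col symb a₀
      ; W-isPLS    = triangles-PLS head col symb hc hs cs
      ; B-isPLS    = triangles-PLS tail col symb tail-col-injective tail-sym-injective cs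
      ; W-mates    = W-mates
      ; B-mates    = B-mates
      }
    ; W-exhaustive = exhaustive head row-occurs′
    ; B-exhaustive = exhaustive tail row-occurs
    }

  private
    module _ {W′ B′ : TripleSet nR nC nS} (trade : IsLatinBitrade W′ B′)
             (W′⊆W : ∀ {t} → T (W′ t) → T (W t)) (B′⊆B : ∀ {t} → T (B′ t) → T (B t)) where
      open IsLatinBitrade trade using () renaming (W-mates to W′-mates; W-nonEmpty to W′-nonEmpty)

      In : Fin nA → Set
      In a = T (W′ (head a , col a , symb a))

      -- A mate in B′ ⊆ B of a triangle in W′ must be its unique mate in B, and
      -- likewise back, so W′ is closed under moving along faces.
      In-col : ∀ {a b} → Consecutive M col a b → In a → In b
      In-col {a} {b} (h , e) i with W′-mates i
      ... | _ , _ , (s , (_ , u) , _) with triangles-sound tail col symb (B′⊆B u)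
      ...   | x , p , q , ≡.refl with tail-col-injective (≡.trans p h) (≡.trans q e)
      ...     | ≡.refl with IsLatinBitrade.B-mates trade u
      ...       | (r , (_ , v) , _) , _ , _ with triangles-sound head col symb (W′⊆W v)
      ...         | y , ≡.refl , q′ , r′ with cs (≡.trans q′ (≡.sym q)) r′
      ...           | ≡.refl = subst (λ c → T (W′ (head b , c , symb b))) (≡.sym q) v

      In-sym : ∀ {a b} → Consecutive M symb a b → In a → In b
      In-sym {a} {b} (h , e) i with W′-mates i
      ... | _ , (c , (_ , u) , _) , _ with triangles-sound tail col symb (B′⊆B u)
      ...   | x , p , ≡.refl , q with tail-sym-injective (≡.trans p h) (≡.trans q e)
      ...     | ≡.refl with IsLatinBitrade.B-mates trade u
      ...       | (r , (_ , v) , _) , _ , _ with triangles-sound head col symb (W′⊆W v)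
      ...         | y , ≡.refl , q′ , r′ with cs q′ (≡.trans r′ (≡.sym q))
      ...           | ≡.refl = subst (λ s → T (W′ (head b , col b , s))) (≡.sym q) v

      In⁺ : ∀ {R : Rel (Fin nA) 0ℓ} → (∀ {a b} → R a b → In a → In b) →
            ∀ {a b} → TransClosure R a b → In a → In b
      In⁺ step [ s ]    = step s
      In⁺ step (s ◅⁺ ss) = In⁺ step ss ∘ step s

      In-star : ∀ {a b} → Star (SharesFace M) a b → In a → In b
      In-star done             = λ i → i
      In-star (inj₁ p ◅ ss) = In-star ss ∘ In⁺ In-col (col-cyclic p)
      In-star (inj₂ p ◅ ss) = In-star ss ∘ In⁺ In-sym (sym-cyclic p)

      whole : ∀ {t} → T (W t) → T (W′ t)
      whole t with W′-nonEmpty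
      ... | _ , i with triangles-sound head col symb (W′⊆W i) | triangles-sound head col symb t
      ...   | a , ≡.refl , ≡.refl , ≡.refl | b , ≡.refl , ≡.refl , ≡.refl = In-star (connected a b) i

  bitrade-spherical : ∀ a₀ → LatinBitrade.IsSpherical (bitrade a₀)
  bitrade-spherical a₀ = record
    { isConnected = λ (W′ , B′ , trade , (W′⊆W , W⊈W′) , (B′⊆B , _)) →
        W⊈W′ (whole {W′} {B′} trade (λ {t} → W′⊆W {t}) (λ {t} → B′⊆B {t}))
    ; isSeparated = rows , columns , symbols
    ; isSphere    = sphere
    }
    where
    open LatinBitrade (bitrade a₀) using (RowSeparated; ColumnSeparated; SymbolSeparated; eulerCharacteristic)

    rows : ∀ r → RowSeparated r
    rows r (c , t) (c′ , u) with triangles-sound head col symb t | triangles-sound head col symb u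
    ... | a , p , _ , ≡.refl | b , q , _ , ≡.refl =
      Star.map (λ { (x , y , h , k , e , ≡.refl , ≡.refl) →
        col x , at head col symb x h ≡.refl ≡.refl , at tail col symb y k (≡.sym e) ≡.refl }) (row-cyclic r p q)

    columns : ∀ c → ColumnSeparated c
    columns c (s , t) (s′ , u) with triangles-sound head col symb t | triangles-sound head col symb u
    ... | a , ≡.refl , p , _ | b , ≡.refl , q , _ =
      -- A column permutes its rows against the direction of the arcs, from the head of an arc to
      -- its tail, which is the head of the arc before it. Hence the reversed path.
      path (col-cyclic (≡.trans q (≡.sym p))) p
      where
      ρ : Rel (Fin nR) 0ℓ
      ρ r r′ = ∃ λ s → T (W (r , c , s)) × T (B (r′ , c , s))

      arc : ∀ {a b} → Consecutive M col b a → col a ≡ c → ρ (head a) (head b)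
      arc {a} (h , _) p =
        symb a , at head col symb a ≡.refl p ≡.refl , at tail col symb a (≡.sym h) p ≡.refl

      path : ∀ {a b} → TransClosure (Consecutive M col) b a → col a ≡ c → Star ρ (head a) (head b)
      path [ s ]    p = arc s p ◅ done
      path (s ◅⁺ ss) p = path ss p ◅◅ arc s (≡.trans (along ss) p) ◅ done
        where
        along : ∀ {a b} → TransClosure (Consecutive M col) b a → col b ≡ col a
        along [ _ , e ]      = e
        along ((_ , e) ◅⁺ ss) = ≡.trans e (along ss)

    symbols : ∀ s → SymbolSeparated s
    symbols s (r , t) (r′ , u) with triangles-sound head col symb t | triangles-sound head col symb u
    ... | a , _ , ≡.refl , p | b , _ , ≡.refl , q = path (sym-cyclic (≡.trans p (≡.sym q))) p
      where
      ρ : Rel (Fin nC) 0ℓ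
      ρ c c′ = ∃ λ r → T (W (r , c , s)) × T (B (r , c′ , s))

      path : ∀ {a b} → TransClosure (Consecutive M symb) a b → symb a ≡ s → Star ρ (col a) (col b)
      path {a} ([_] {y = b} (h , e)) p =
        (head a , at head col symb a ≡.refl ≡.refl p , at tail col symb b (≡.sym h) ≡.refl (≡.trans (≡.sym e) p)) ◅ done
      path {a} (_◅⁺_ {y = b} (h , e) ss) p =
        (head a , at head col symb a ≡.refl ≡.refl p , at tail col symb b (≡.sym h) ≡.refl (≡.trans (≡.sym e) p)) ◅
        path ss (≡.trans (≡.sym e) p)

    -- With `3 nA` edges and `2 nA` faces the characteristic is the number of vertices minus `nA`,
    -- which `euler` makes 2.
    sphere : eulerCharacteristic ≡ ℤ.+ 2
    sphere = ≡.trans (cong₂ (λ e n → ℤ.+ (nR + nC + nS) ℤ.- ℤ.+ e ℤ.+ ℤ.+ n)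
                     (edges-triangles head col symb hc hs cs)
                     (cong₂ _+_ (size-triangles head col symb hc hs cs)
                                (size-triangles tail col symb tail-col-injective tail-sym-injective cs)))
      (≡.trans (cong (λ v → ℤ.+ v ℤ.- ℤ.+ (nA + nA + nA) ℤ.+ ℤ.+ (nA + nA)) euler)
             (cancel (ℤ.+ nA)))
      where
      cancel : ∀ x → (ℤ.+ 2 ℤ.+ x) ℤ.- (x ℤ.+ x ℤ.+ x) ℤ.+ (x ℤ.+ x) ≡ ℤ.+ 2
      cancel = ℤSolver.solve-∀

-- Linear identities in abelian groups

Group₀ : Set₁
Group₀ = AbelianGroup 0ℓ 0ℓ

mapTerm : ∀ {X Y : Set} → (X → Y) → Term X → Term Y
mapTerm f (gen x) = gen (f x)
mapTerm f 𝟎       = 𝟎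
mapTerm f (t ⊞ u) = mapTerm f t ⊞ mapTerm f u
mapTerm f (⊟ t)   = ⊟ mapTerm f t

module Evaluation (H : Group₀) where
  open AbelianGroup H
  open AbelianGroupProperties H
  open Mult commutativeMonoid using (×-congʳ; ×-homo-+; ×-distrib-+; ×-assocˡ; ×-congˡ)
    renaming (_×_ to _·_) public
  open import Relation.Binary.Reasoning.Setoid setoid

  eval : ∀ {X : Set} → (X → Carrier) → Term X → Carrier
  eval ρ (gen x) = ρ x
  eval ρ 𝟎       = ε
  eval ρ (t ⊞ u) = eval ρ t ∙ eval ρ u
  eval ρ (⊟ t)   = eval ρ t ⁻¹

  eval-mapTerm : ∀ {X Y : Set} (ρ : Y → Carrier) (f : X → Y) t → eval ρ (mapTerm f t) ≡ eval (ρ ∘ f) t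
  eval-mapTerm ρ f (gen x) = ≡.refl
  eval-mapTerm ρ f 𝟎       = ≡.refl
  eval-mapTerm ρ f (t ⊞ u) = cong₂ _∙_ (eval-mapTerm ρ f t) (eval-mapTerm ρ f u)
  eval-mapTerm ρ f (⊟ t)   = cong _⁻¹ (eval-mapTerm ρ f t)

  eval-cong : ∀ {X : Set} {ρ σ : X → Carrier} → (∀ x → ρ x ≈ σ x) → ∀ t → eval ρ t ≈ eval σ t
  eval-cong h (gen x) = h x
  eval-cong h 𝟎       = refl
  eval-cong h (t ⊞ u) = ∙-cong (eval-cong h t) (eval-cong h u)
  eval-cong h (⊟ t)   = ⁻¹-cong (eval-cong h t)

  infixr 8 _∗_
  _∗_ : ℤ → Carrier → Carrier
  (ℤ.+ n)  ∗ x = n · x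
  -[1+ n ] ∗ x = (suc n · x) ⁻¹

  ·-ε : ∀ n → n · ε ≈ ε
  ·-ε zero    = refl
  ·-ε (suc n) = trans (identityˡ _) (·-ε n)

  ∙-zero-· : ∀ {n} x y → n ≡ 0 → x ∙ n · y ≈ x
  ∙-zero-· x y ≡.refl = identityʳ x

  ·-⁻¹ : ∀ n x → n · (x ⁻¹) ≈ (n · x) ⁻¹
  ·-⁻¹ zero    x = sym ε⁻¹≈ε
  ·-⁻¹ (suc n) x = trans (∙-congˡ (·-⁻¹ n x)) (⁻¹-∙-comm x (n · x))

  ⊖-∗ : ∀ m n x → (m ⊖ n) ∗ x ≈ m · x - n · x
  ⊖-∗ zero    zero    x = sym (trans (identityˡ _) ε⁻¹≈ε)
  ⊖-∗ zero    (suc n) x = sym (identityˡ _)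
  ⊖-∗ (suc m) zero    x = sym (trans (∙-congˡ ε⁻¹≈ε) (identityʳ _))
  ⊖-∗ (suc m) (suc n) x = begin
    (suc m ⊖ suc n) ∗ x                ≡⟨ cong (_∗ x) (ℤ.[1+m]⊖[1+n]≡m⊖n m n) ⟩
    (m ⊖ n) ∗ x                        ≈⟨ ⊖-∗ m n x ⟩
    m · x - n · x                      ≈⟨ ∙-congʳ (sym (xyx⁻¹≈y x (m · x))) ⟩
    x ∙ m · x - x - n · x              ≈⟨ assoc _ _ _ ⟩
    x ∙ m · x ∙ (x ⁻¹ ∙ (n · x) ⁻¹)    ≈⟨ ∙-congˡ (⁻¹-∙-comm x (n · x)) ⟩
    x ∙ m · x - (x ∙ n · x)            ∎

  ∗-homo-+ : ∀ i j x → (i ℤ.+ j) ∗ x ≈ i ∗ x ∙ j ∗ x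
  ∗-homo-+ (ℤ.+ m)  (ℤ.+ n)  x = ×-homo-+ x m n
  ∗-homo-+ (ℤ.+ m)  -[1+ n ] x = ⊖-∗ m (suc n) x
  ∗-homo-+ -[1+ m ] (ℤ.+ n)  x = trans (⊖-∗ n (suc m) x) (comm _ _)
  ∗-homo-+ -[1+ m ] -[1+ n ] x = begin
    (suc (suc (m ℕ.+ n)) · x) ⁻¹         ≡⟨ cong (λ k → (suc k · x) ⁻¹) (ℕ.+-suc m n) ⟨
    ((suc m ℕ.+ suc n) · x) ⁻¹           ≈⟨ ⁻¹-cong (×-homo-+ x (suc m) (suc n)) ⟩
    (suc m · x ∙ suc n · x) ⁻¹           ≈⟨ ⁻¹-∙-comm _ _ ⟨
    (suc m · x) ⁻¹ ∙ (suc n · x) ⁻¹      ∎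

  ∗-neg : ∀ i x → (ℤ.- i) ∗ x ≈ (i ∗ x) ⁻¹
  ∗-neg (ℤ.+ zero)  x = sym ε⁻¹≈ε
  ∗-neg (ℤ.+ suc n) x = refl
  ∗-neg -[1+ n ]    x = sym (⁻¹-involutive _)

  ∗-cong : ∀ i {x y} → x ≈ y → i ∗ x ≈ i ∗ y
  ∗-cong (ℤ.+ n)  e = ×-congʳ n e
  ∗-cong -[1+ n ] e = ⁻¹-cong (×-congʳ (suc n) e)

  ∗-ε : ∀ i → i ∗ ε ≈ ε
  ∗-ε (ℤ.+ n)  = ·-ε n
  ∗-ε -[1+ n ] = trans (⁻¹-cong (·-ε (suc n))) ε⁻¹≈ε

  private
    module Sums = CommutativeMonoidSum commutativeMonoid

  coefficient : ∀ {n} → Term (Fin n) → Fin n → ℤ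
  coefficient (gen j) i = if does (j ≟ i) then ℤ.1ℤ else ℤ.0ℤ
  coefficient 𝟎       i = ℤ.0ℤ
  coefficient (t ⊞ u) i = coefficient t i ℤ.+ coefficient u i
  coefficient (⊟ t)   i = ℤ.- coefficient t i

  eval-coefficients : ∀ {n} (ρ : Fin n → Carrier) t → eval ρ t ≈ Sums.sum λ i → coefficient t i ∗ ρ i
  eval-coefficients {n} ρ (gen j) = single ρ j
    where
    single : ∀ {n} (ρ : Fin n → Carrier) j → ρ j ≈ Sums.sum λ i → coefficient (gen j) i ∗ ρ i
    single {suc n} ρ zero    = sym (trans (∙-cong (identityʳ _) (Sums.sum-replicate-zero n)) (identityʳ _))
    single {suc n} ρ (suc j) = trans (single (ρ ∘ suc) j) (sym (identityˡ _))
  eval-coefficients {n} ρ 𝟎 = sym (Sums.sum-replicate-zero n)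
  eval-coefficients ρ (t ⊞ u) = begin
    eval ρ t ∙ eval ρ u
      ≈⟨ ∙-cong (eval-coefficients ρ t) (eval-coefficients ρ u) ⟩
    Sums.sum (λ i → coefficient t i ∗ ρ i) ∙ Sums.sum (λ i → coefficient u i ∗ ρ i)
      ≈⟨ Sums.∑-distrib-+ (λ i → coefficient t i ∗ ρ i) (λ i → coefficient u i ∗ ρ i) ⟨
    Sums.sum (λ i → coefficient t i ∗ ρ i ∙ coefficient u i ∗ ρ i)
      ≈⟨ Sums.sum-cong-≋ (λ i → ∗-homo-+ (coefficient t i) (coefficient u i) (ρ i)) ⟨
    Sums.sum (λ i → coefficient (t ⊞ u) i ∗ ρ i) ∎
  eval-coefficients ρ (⊟ t) = trans (⁻¹-cong (eval-coefficients ρ t)) (negate ρ (coefficient t))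
    where
    negate : ∀ {n} (ρ : Fin n → Carrier) (k : Fin n → ℤ) →
             Sums.sum (λ i → k i ∗ ρ i) ⁻¹ ≈ Sums.sum (λ i → (ℤ.- k i) ∗ ρ i)
    negate {zero}  ρ k = ε⁻¹≈ε
    negate {suc n} ρ k = trans (sym (⁻¹-∙-comm _ _))
      (∙-cong (sym (∗-neg (k zero) (ρ zero))) (negate (ρ ∘ suc) (k ∘ suc)))

  -- For concrete terms the coefficients compute, so each use is closed by `≡.refl`; `tabulate`
  -- packs all of them into one equation. Multiples by a variable number have to be passed as atoms.
  linear : ∀ {n} (ρ : Fin n → Carrier) (t u : Term (Fin n)) →
           tabulate (coefficient t) ≡ tabulate (coefficient u) → eval ρ t ≈ eval ρ u
  linear ρ t u e = begin
    eval ρ t                              ≈⟨ eval-coefficients ρ t ⟩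
    Sums.sum (λ i → coefficient t i ∗ ρ i)   ≈⟨ Sums.sum-cong-≋ (λ i → reflexive (cong (_∗ ρ i) (pointwise i))) ⟩
    Sums.sum (λ i → coefficient u i ∗ ρ i)   ≈⟨ eval-coefficients ρ u ⟨
    eval ρ u                              ∎
    where
    pointwise : ∀ i → coefficient t i ≡ coefficient u i
    pointwise i = ≡.trans (≡.sym (lookup∘tabulate (coefficient t) i))
      (≡.trans (cong (λ v → Vec.lookup v i) e) (lookup∘tabulate (coefficient u) i))

  eval-ε : ∀ {X : Set} {ρ : X → Carrier} → (∀ x → ρ x ≈ ε) → ∀ t → eval ρ t ≈ ε
  eval-ε h (gen x) = h x
  eval-ε h 𝟎       = refl
  eval-ε h (t ⊞ u) = trans (∙-cong (eval-ε h t) (eval-ε h u)) (identityˡ ε)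
  eval-ε h (⊟ t)   = trans (⁻¹-cong (eval-ε h t)) ε⁻¹≈ε

  substitute : ∀ {X Y : Set} → (X → Term Y) → Term X → Term Y
  substitute σ (gen x) = σ x
  substitute σ 𝟎       = 𝟎
  substitute σ (t ⊞ u) = substitute σ t ⊞ substitute σ u
  substitute σ (⊟ t)   = ⊟ substitute σ t

  eval-substitute : ∀ {X Y : Set} (ρ : Y → Carrier) (σ : X → Term Y) t →
                    eval ρ (substitute σ t) ≡ eval (eval ρ ∘ σ) t
  eval-substitute ρ σ (gen x) = ≡.refl
  eval-substitute ρ σ 𝟎       = ≡.refl
  eval-substitute ρ σ (t ⊞ u) = cong₂ _∙_ (eval-substitute ρ σ t) (eval-substitute ρ σ u)
  eval-substitute ρ σ (⊟ t)   = cong _⁻¹ (eval-substitute ρ σ t)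

  -- The term `c` is the certificate: the integer combination of the vanishing elements `zs` by
  -- which `t` and `u` differ.
  linear-modulo : ∀ {k n} (ρ : Fin n → Carrier) (zs : Fin k → Term (Fin n)) →
                  (∀ i → eval ρ (zs i) ≈ ε) → (c : Term (Fin k)) (t u : Term (Fin n)) →
                  tabulate (coefficient t) ≡ tabulate (coefficient (u ⊞ substitute zs c)) →
                  eval ρ t ≈ eval ρ u
  linear-modulo ρ zs zs≈ε c t u e = begin
    eval ρ t                              ≈⟨ linear ρ t (u ⊞ substitute zs c) e ⟩
    eval ρ u ∙ eval ρ (substitute zs c)   ≡⟨ cong (eval ρ u ∙_) (eval-substitute ρ zs c) ⟩
    eval ρ u ∙ eval (eval ρ ∘ zs) c       ≈⟨ ∙-congˡ (eval-ε zs≈ε c) ⟩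
    eval ρ u ∙ ε                          ≈⟨ identityʳ _ ⟩
    eval ρ u                              ∎

  ∗-multiple : ∀ {d x} → d · x ≈ ε → ∀ q → (q ℤ.* ℤ.+ d) ∗ x ≈ ε
  ∗-multiple {d} {x} h (ℤ.+ n) = begin
    (ℤ.+ n ℤ.* ℤ.+ d) ∗ x  ≡⟨ cong (_∗ x) (ℤ.pos-* n d) ⟨
    (n ℕ.* d) · x          ≈⟨ ×-assocˡ x n d ⟨
    n · (d · x)            ≈⟨ ×-congʳ n h ⟩
    n · ε                  ≈⟨ ·-ε n ⟩
    ε                      ∎
  ∗-multiple {d} {x} h -[1+ n ] = begin
    (-[1+ n ] ℤ.* ℤ.+ d) ∗ x         ≡⟨ cong (_∗ x) (ℤ.neg-distribˡ-* (ℤ.+ suc n) (ℤ.+ d)) ⟨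
    (ℤ.- (ℤ.+ suc n ℤ.* ℤ.+ d)) ∗ x  ≈⟨ ∗-neg (ℤ.+ suc n ℤ.* ℤ.+ d) x ⟩
    ((ℤ.+ suc n ℤ.* ℤ.+ d) ∗ x) ⁻¹   ≈⟨ ⁻¹-cong (∗-multiple {d} {x} h (ℤ.+ suc n)) ⟩
    ε ⁻¹                             ≈⟨ ε⁻¹≈ε ⟩
    ε                                ∎

  ∗-congruent : ∀ {d x i j} → d · x ≈ ε → Congruent d i j → i ∗ x ≈ j ∗ x
  ∗-congruent {d} {x} {i} {j} h (congruent (divides q e)) = begin
    i ∗ x                          ≡⟨ cong (_∗ x) i≡j+qd ⟩
    (j ℤ.+ q ℤ.* ℤ.+ d) ∗ x        ≈⟨ ∗-homo-+ j (q ℤ.* ℤ.+ d) x ⟩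
    j ∗ x ∙ (q ℤ.* ℤ.+ d) ∗ x      ≈⟨ ∙-congˡ (∗-multiple {d} {x} h q) ⟩
    j ∗ x ∙ ε                      ≈⟨ identityʳ _ ⟩
    j ∗ x                          ∎
    where
    i≡j+qd : i ≡ j ℤ.+ q ℤ.* ℤ.+ d
    i≡j+qd = ≡.trans (cancel i j) (cong (λ k → j ℤ.+ k) e)
      where
      cancel : ∀ i j → i ≡ j ℤ.+ (i ℤ.- j)
      cancel = ℤSolver.solve-∀

multiple⁺ : ∀ {X : Set} → ℕ → Term X → Term X
multiple⁺ zero    t = 𝟎
multiple⁺ (suc n) t = t ⊞ multiple⁺ n t

multiple : ∀ {X : Set} → ℤ → Term X → Term X
multiple (ℤ.+ n)  t = multiple⁺ n t
multiple -[1+ n ] t = ⊟ multiple⁺ (suc n) t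

module _ (H : Group₀) where
  open AbelianGroup H
  open Evaluation H

  eval-multiple⁺ : ∀ {X : Set} (ρ : X → Carrier) n t → eval ρ (multiple⁺ n t) ≡ n · eval ρ t
  eval-multiple⁺ ρ zero    t = ≡.refl
  eval-multiple⁺ ρ (suc n) t = cong (eval ρ t ∙_) (eval-multiple⁺ ρ n t)

  eval-multiple : ∀ {X : Set} (ρ : X → Carrier) i t → eval ρ (multiple i t) ≡ i ∗ eval ρ t
  eval-multiple ρ (ℤ.+ n)  t = eval-multiple⁺ ρ n t
  eval-multiple ρ -[1+ n ] t = cong _⁻¹ (eval-multiple⁺ ρ (suc n) t)

-- Homomorphisms of abelian groups

module _ {g₁ g₂ h₁ h₂ : Level} (G : AbelianGroup g₁ g₂) (H : AbelianGroup h₁ h₂) where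
  private
    module G = AbelianGroup G
    module H = AbelianGroup H

  module _ (f : G.Carrier → H.Carrier)
           (f-cong : ∀ {x y} → x G.≈ y → f x H.≈ f y)
           (f-homo : ∀ x y → f (x G.∙ y) H.≈ f x H.∙ f y) where

    homo-ε : f G.ε H.≈ H.ε
    homo-ε = P.identityˡ-unique _ _ (H.trans (H.sym (f-homo G.ε G.ε)) (f-cong (G.identityˡ G.ε)))
      where module P = AbelianGroupProperties H

    homo-⁻¹ : ∀ x → f (x G.⁻¹) H.≈ f x H.⁻¹
    homo-⁻¹ x = P.inverseˡ-unique _ _
      (H.trans (H.sym (f-homo (x G.⁻¹) x)) (H.trans (f-cong (G.inverseˡ x)) homo-ε))
      where module P = AbelianGroupProperties H

    isomorphism : (∀ {x y} → f x H.≈ f y → x G.≈ y) → (∀ y → ∃ λ x → f x H.≈ y) → G ≅ H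
    isomorphism injective surjective = f , record
      { isGroupMonomorphism = record
        { isGroupHomomorphism = record
          { isMonoidHomomorphism = record
            { isMagmaHomomorphism = record
              { isRelHomomorphism = record { cong = f-cong }
              ; homo = f-homo
              }
            ; ε-homo = homo-ε
            }
          ; ⁻¹-homo = homo-⁻¹
          }
        ; injective = injective
        }
      ; surjective = λ y → let x , e = surjective y in x , λ z≈x → H.trans (f-cong z≈x) e
      }

module _ (G H : Group₀) where
  private
    module G = AbelianGroup G
    module H = AbelianGroup H
    module EG = Evaluation G
    module EH = Evaluation H

  homo-· : (f : G.Carrier → H.Carrier) → (∀ {x y} → x G.≈ y → f x H.≈ f y) →
           (∀ x y → f (x G.∙ y) H.≈ f x H.∙ f y) → ∀ n x → f (n EG.· x) H.≈ n EH.· f x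
  homo-· f f-cong f-homo zero    x = homo-ε G H f f-cong f-homo
  homo-· f f-cong f-homo (suc n) x =
    H.trans (f-homo _ _) (H.∙-congˡ (homo-· f f-cong f-homo n x))

-- The canonical group of a map

Vertex : Map → Set
Vertex M = Fin (Map.nR M) ⊎ Fin (Map.nC M) ⊎ Fin (Map.nS M)

pattern row r = inj₁ r
pattern column c = inj₂ (inj₁ c)
pattern symbol s = inj₂ (inj₂ s)

-- A bundle of 2e + 1 arcs contributes the relations of its 2e + 1 white
-- triangles; eliminating the 2e digons between them leaves this single one.

module _ (M : Map) (H : Group₀) where
  open Map M
  open AbelianGroup H
  open Evaluation H

  IsModel : (Vertex M → Carrier) → Set
  IsModel ℓ = ∀ a →
    ℓ (row (head a)) ∙ ℓ (column (col a)) ∙ ℓ (symbol (symb a)) ∙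
      excess a · (ℓ (row (head a)) - ℓ (row (tail a))) ≈ ε

Annihilates : (M : Map) → ℕ → Term (Vertex M) → Set₁
Annihilates M d t = (H : Group₀) →
  let open AbelianGroup H
      open Evaluation H
  in ∀ ℓ → IsModel M H ℓ → d · eval ℓ t ≈ ε

-- The part of a vertex in the two torsion-free directions. A symbol receives minus the sum so that
-- row, column and symbol of any triangle add up to zero.
baseTerm : (M : Map) → Fin (Map.nR M) → Fin (Map.nC M) → Vertex M → Term (Vertex M)
baseTerm M r c (row _)    = gen (row r)
baseTerm M r c (column _) = gen (column c)
baseTerm M r c (symbol _) = ⊟ (gen (row r) ⊞ gen (column c))

-- Labels map onto `G`, and `word` splits that map in every model. By `word-label`, what the
-- splitting misses is spanned by the base row and the base column; `exponent` makes `G` a torsion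
-- group.
record Coordinates (M : Map) (G : Group₀) : Set₁ where
  open Map M
  private
    module G = AbelianGroup G
    module EG = Evaluation G
  field
    label       : Vertex M → G.Carrier
    label-model : IsModel M G label
    word        : G.Carrier → Term (Vertex M)
    baseRow     : Fin nR
    baseColumn  : Fin nC
    word-cong  : (H : Group₀) →
      let open AbelianGroup H
          open Evaluation H
      in ∀ ℓ → IsModel M H ℓ → ∀ {x y} → x G.≈ y → eval ℓ (word x) ≈ eval ℓ (word y)
    word-homo  : (H : Group₀) →
      let open AbelianGroup H
          open Evaluation H
      in ∀ ℓ → IsModel M H ℓ → ∀ x y → eval ℓ (word (x G.∙ y)) ≈ eval ℓ (word x) ∙ eval ℓ (word y)
    word-label : (H : Group₀) →
      let open AbelianGroup H
          open Evaluation H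
      in ∀ ℓ → IsModel M H ℓ → ∀ v → ℓ v ≈ eval ℓ (word (label v)) ∙ eval ℓ (baseTerm M baseRow baseColumn v)
    label-word : ∀ x → EG.eval label (word x) G.≈ x
    exponent   : ∃ λ e → 1 ≤ e × ∀ x → e EG.· x G.≈ G.ε

module _ (M : Map) (valid : Spherical M) (plain : ∀ a → Map.excess M a ≡ 0) (loopless : Loopless M)
         (a₀ : Fin (Map.nA M)) (G : Group₀) (coordinates : Coordinates M G) where
  open Map M
  open Coordinates coordinates

  private
    base : Vertex M → Term (Vertex M)
    base = baseTerm M baseRow baseColumn

  private
    trade = bitrade M valid plain loopless a₀

  open LatinBitrade trade using (𝒜; Relator; triple)

  private
    module G = AbelianGroup G
    module EG = Evaluation G
    module 𝒜 = AbelianGroup 𝒜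
    module E𝒜 = Evaluation 𝒜

    eval-respects : (H : Group₀) →
      let open AbelianGroup H
          open Evaluation H
      in ∀ ℓ → (∀ {t} → Relator t → eval ℓ t ≈ ε) → ∀ {t u} → t 𝒜.≈ u → eval ℓ t ≈ eval ℓ u
    eval-respects H ℓ r = go
      where
      open AbelianGroup H
      open Evaluation H
      go : ∀ {t u} → t 𝒜.≈ u → eval ℓ t ≈ eval ℓ u
      go (≋-relator x)   = r x
      go ≋-refl          = refl
      go (≋-sym e)       = sym (go e)
      go (≋-trans e f)   = trans (go e) (go f)
      go (⊞-cong e f)    = ∙-cong (go e) (go f)
      go (⊟-cong e)      = ⁻¹-cong (go e)
      go (⊞-assoc _ _ _) = assoc _ _ _
      go (⊞-comm _ _)    = comm _ _
      go (⊞-identityˡ _) = identityˡ _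
      go (⊞-inverseˡ _)  = inverseˡ _

    label-relator : ∀ {t} → Relator t → EG.eval label t G.≈ G.ε
    label-relator (triple t) with triangles-sound head col symb t
    ... | a , ≡.refl , ≡.refl , ≡.refl = G.trans (G.sym (EG.∙-zero-· _ _ (plain a))) (label-model a)

    gen-model : IsModel M 𝒜 gen
    gen-model a = 𝒜.trans (E𝒜.∙-zero-· _ _ (plain a))
      (≋-relator (triple (triangles-complete head col symb a)))

    eval-gen : ∀ t → E𝒜.eval gen t ≡ t
    eval-gen (gen x) = ≡.refl
    eval-gen 𝟎       = ≡.refl
    eval-gen (t ⊞ u) = cong₂ _⊞_ (eval-gen t) (eval-gen u)
    eval-gen (⊟ t)   = cong ⊟_ (eval-gen t)

    φ : 𝒜.Carrier → G.Carrier
    φ = EG.eval label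

    ψ : G.Carrier → 𝒜.Carrier
    ψ x = E𝒜.eval gen (word x)

    ψ-cong : ∀ {x y} → x G.≈ y → ψ x 𝒜.≈ ψ y
    ψ-cong = word-cong 𝒜 gen gen-model

    ψ-homo : ∀ x y → ψ (x G.∙ y) 𝒜.≈ ψ x 𝒜.∙ ψ y
    ψ-homo = word-homo 𝒜 gen gen-model

    split : ∀ t → t 𝒜.≈ ψ (φ t) 𝒜.∙ E𝒜.eval base t
    split (gen v) = 𝒜.trans (word-label 𝒜 gen gen-model v) (𝒜.∙-congˡ (𝒜.reflexive (eval-gen (base v))))
    split 𝟎       = 𝒜.sym (𝒜.trans (𝒜.∙-congʳ (homo-ε G 𝒜 ψ ψ-cong ψ-homo)) (𝒜.identityˡ _))
    split (t ⊞ u) = 𝒜.trans (𝒜.∙-cong (split t) (split u))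
      (𝒜.trans (E𝒜.linear (ψ (φ t) ∷ E𝒜.eval base t ∷ ψ (φ u) ∷ E𝒜.eval base u ∷ [])
        (gen zero ⊞ gen (suc zero) ⊞ (gen (suc (suc zero)) ⊞ gen (suc (suc (suc zero)))))
        (gen zero ⊞ gen (suc (suc zero)) ⊞ (gen (suc zero) ⊞ gen (suc (suc (suc zero))))) ≡.refl)
      (𝒜.∙-congʳ (𝒜.sym (ψ-homo _ _))))
    split (⊟ t)   = 𝒜.trans (𝒜.⁻¹-cong (split t))
      (𝒜.trans (𝒜.sym (AbelianGroupProperties.⁻¹-∙-comm 𝒜 _ _))
        (𝒜.∙-congʳ (𝒜.sym (homo-⁻¹ G 𝒜 ψ ψ-cong ψ-homo _))))

    module Eℤ = Evaluation ℤ.+-0-abelianGroup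

    -- The two gradings of 𝒜 that account for its torsion-free part.
    rowDegree columnDegree : Vertex M → ℤ
    rowDegree (row _)       = ℤ.+ 1
    rowDegree (column _)    = ℤ.+ 0
    rowDegree (symbol _)    = -[1+ 0 ]
    columnDegree (row _)    = ℤ.+ 0
    columnDegree (column _) = ℤ.+ 1
    columnDegree (symbol _) = -[1+ 0 ]

    base-degrees : ∀ t → E𝒜.eval base t 𝒜.≈
      Eℤ.eval rowDegree t E𝒜.∗ gen (row baseRow) 𝒜.∙ Eℤ.eval columnDegree t E𝒜.∗ gen (column baseColumn)
    base-degrees (gen (row _))    = E𝒜.linear (gen (row baseRow) ∷ []) (gen zero) (gen zero ⊞ 𝟎 ⊞ 𝟎) ≡.refl
    base-degrees (gen (column _)) = E𝒜.linear (gen (column baseColumn) ∷ []) (gen zero) (𝟎 ⊞ (gen zero ⊞ 𝟎)) ≡.refl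
    base-degrees (gen (symbol _)) = E𝒜.linear (gen (row baseRow) ∷ gen (column baseColumn) ∷ [])
      (⊟ (gen zero ⊞ gen (suc zero))) (⊟ (gen zero ⊞ 𝟎) ⊞ ⊟ (gen (suc zero) ⊞ 𝟎)) ≡.refl
    base-degrees 𝟎       = 𝒜.sym (𝒜.identityˡ 𝒜.ε)
    base-degrees (t ⊞ u) = 𝒜.trans (𝒜.∙-cong (base-degrees t) (base-degrees u))
      (𝒜.trans (E𝒜.linear (_ ∷ _ ∷ _ ∷ _ ∷ [])
        (gen zero ⊞ gen (suc zero) ⊞ (gen (suc (suc zero)) ⊞ gen (suc (suc (suc zero)))))
        (gen zero ⊞ gen (suc (suc zero)) ⊞ (gen (suc zero) ⊞ gen (suc (suc (suc zero))))) ≡.refl)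
      (𝒜.∙-cong (𝒜.sym (E𝒜.∗-homo-+ (Eℤ.eval rowDegree t) (Eℤ.eval rowDegree u) _))
                (𝒜.sym (E𝒜.∗-homo-+ (Eℤ.eval columnDegree t) (Eℤ.eval columnDegree u) _))))
    base-degrees (⊟ t)   = 𝒜.trans (𝒜.⁻¹-cong (base-degrees t))
      (𝒜.trans (𝒜.sym (AbelianGroupProperties.⁻¹-∙-comm 𝒜 _ _))
        (𝒜.∙-cong (𝒜.sym (E𝒜.∗-neg (Eℤ.eval rowDegree t) _))
                  (𝒜.sym (E𝒜.∗-neg (Eℤ.eval columnDegree t) _))))

    multiple-zero : ∀ m (x : ℤ) → 1 ≤ m → m Eℤ.· x ≡ ℤ.0ℤ → x ≡ ℤ.0ℤ
    multiple-zero (suc m) x _ e with ℤ.i*j≡0⇒i≡0∨j≡0 (ℤ.+ suc m) (≡.trans (≡.sym (product (suc m))) e)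
      where
      product : ∀ m → m Eℤ.· x ≡ ℤ.+ m ℤ.* x
      product zero    = ≡.sym (ℤ.*-zeroˡ x)
      product (suc m) = ≡.trans (cong (λ y → x ℤ.+ y) (product m)) (≡.sym (ℤ.suc-* (ℤ.+ m) x))
    ... | inj₁ ()
    ... | inj₂ x≡0 = x≡0

    -- A grading that vanishes on the relators is a homomorphism from `𝒜` to the torsion-free group
    -- ℤ.
    degree-zero : ∀ (d : Vertex M → ℤ) → (∀ {t} → Relator t → Eℤ.eval d t ≡ ℤ.0ℤ) →
                  ∀ {t} → IsTorsion 𝒜 t → Eℤ.eval d t ≡ ℤ.0ℤ
    degree-zero d r {t} (m , 1≤m , e) = multiple-zero m _ 1≤m
      (≡.trans (≡.sym (homo-· 𝒜 ℤ.+-0-abelianGroup (Eℤ.eval d) resp (λ _ _ → ≡.refl) m t)) (resp e))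
      where
      resp : ∀ {t u} → t 𝒜.≈ u → Eℤ.eval d t ≡ Eℤ.eval d u
      resp = eval-respects ℤ.+-0-abelianGroup d r

    torsion-base : ∀ {t} → IsTorsion 𝒜 t → E𝒜.eval base t 𝒜.≈ 𝒜.ε
    torsion-base {t} τ = 𝒜.trans (base-degrees t)
      (𝒜.trans (𝒜.reflexive (cong₂ (λ i j → i E𝒜.∗ _ 𝒜.∙ j E𝒜.∗ _)
        (degree-zero rowDegree (λ { (triple _) → ≡.refl }) τ)
        (degree-zero columnDegree (λ { (triple _) → ≡.refl }) τ))) (𝒜.identityˡ 𝒜.ε))

    torsion-split : ∀ {t} → IsTorsion 𝒜 t → t 𝒜.≈ ψ (φ t)
    torsion-split {t} τ = 𝒜.trans (split t) (𝒜.trans (𝒜.∙-congˡ (torsion-base τ)) (𝒜.identityʳ _))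

    ψ-torsion : ∀ x → IsTorsion 𝒜 (ψ x)
    ψ-torsion x with exponent
    ... | e , 1≤e , kills = e , 1≤e , 𝒜.trans (𝒜.sym (homo-· G 𝒜 ψ ψ-cong ψ-homo e x))
      (𝒜.trans (ψ-cong (kills x)) (homo-ε G 𝒜 ψ ψ-cong ψ-homo))

  -- On torsion both degrees vanish, so the base part drops out of `split` and `ψ` inverts `φ`. The
  -- image of `ψ` is torsion because `G` has finite exponent.
  canonicalGroup-≅ : canonicalGroup trade ≅ G
  canonicalGroup-≅ = isomorphism (canonicalGroup trade) G (φ ∘ proj₁)
    (eval-respects G label label-relator)
    (λ _ _ → G.refl)
    (λ {(t , τ)} {(u , υ)} e → 𝒜.trans (torsion-split τ) (𝒜.trans (ψ-cong e) (𝒜.sym (torsion-split υ))))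
    (λ x → (ψ x , ψ-torsion x) ,
           G.trans (G.reflexive (cong φ (eval-gen (word x)))) (label-word x))

module _ {M : Map} (H : Group₀) where
  open AbelianGroup H
  open Evaluation H
  open Map M

  -- The condition of `IsModel` at one arc, with ends, faces and excess as variables so that
  -- equations between them can be matched with `≡.refl`.
  ArcRelation : (Vertex M → Carrier) → (h t : Fin nR) → Fin nC → Fin nS → ℕ → Set
  ArcRelation ℓ h t c s e = ℓ (row h) ∙ ℓ (column c) ∙ ℓ (symbol s) ∙ e · (ℓ (row h) - ℓ (row t)) ≈ ε

module Generation (G H : Group₀) (ω : AbelianGroup.Carrier G → AbelianGroup.Carrier H)
  (ω-cong : ∀ {x y} → AbelianGroup._≈_ G x y → AbelianGroup._≈_ H (ω x) (ω y))
  (ω-homo : ∀ x y → AbelianGroup._≈_ H (ω (AbelianGroup._∙_ G x y)) (AbelianGroup._∙_ H (ω x) (ω y))) where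
  private
    module G = AbelianGroup G
    module EG = Evaluation G
  open AbelianGroup H
  open Evaluation H

  -- The form of `word-label`, for arbitrary elements in place of a vertex and its label. It is
  -- closed under sums and inverses, so the case of a new vertex follows the formula that defines
  -- its label.
  record Generates (x : G.Carrier) (b e : Carrier) : Set where
    constructor generates
    field
      equation : e ≈ ω x ∙ b

  open Generates public

  generates-∙ : ∀ {x y b c e f} → Generates x b e → Generates y c f → Generates (x G.∙ y) (b ∙ c) (e ∙ f)
  generates-∙ {x} {y} {b} {c} (generates g) (generates h) = generates (trans (∙-cong g h)
    (trans (linear (ω x ∷ b ∷ ω y ∷ c ∷ [])
        (gen 0F ⊞ gen 1F ⊞ (gen 2F ⊞ gen 3F)) (gen 0F ⊞ gen 2F ⊞ (gen 1F ⊞ gen 3F)) ≡.refl)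
      (∙-congʳ (sym (ω-homo x y)))))

  generates-⁻¹ : ∀ {x b e} → Generates x b e → Generates (x G.⁻¹) (b ⁻¹) (e ⁻¹)
  generates-⁻¹ {x} {b} (generates g) = generates (trans (⁻¹-cong g)
    (trans (sym (AbelianGroupProperties.⁻¹-∙-comm H (ω x) b)) (∙-congʳ (sym (homo-⁻¹ G H ω ω-cong ω-homo x)))))

  generates-resp : ∀ {x y b c e f} → x G.≈ y → b ≈ c → e ≈ f → Generates x b e → Generates y c f
  generates-resp p q r (generates g) = generates (trans (sym r) (trans g (∙-cong (ω-cong p) q)))

  generates-· : ∀ n {x e} → Generates x ε e → Generates (n EG.· x) ε (n · e)
  generates-· zero    g = generates (sym (trans (identityʳ _) (homo-ε G H ω ω-cong ω-homo)))
  generates-· (suc n) g = generates-resp G.refl (identityˡ ε) refl (generates-∙ g (generates-· n g))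

-- Opening a bundle leaves the group unchanged

module UnbundlingCoordinates (M : Map) (f : Fin (Map.nA M)) (j : ℕ) (f-excess : Map.excess M f ≡ suc j)
                             (G : Group₀) (coordinates : Coordinates M G) where
  open Map M
  open Unbundling M f j using (col-f; col-≢; excess-f; excess-≢)
  open Coordinates coordinates
  private
    M′ = unbundle M f j
    module M′ = Map M′
    module G = AbelianGroup G
    module EG = Evaluation G

  ι : Vertex M → Vertex M′
  ι (row r)    = row r
  ι (column c) = column (suc c)
  ι (symbol s) = symbol (suc s)

  private
    U V C S C′ S′ A forth back last : Term (Fin 7)
    U = gen 0F ; V = gen 1F ; C = gen 2F ; S = gen 3F ; C′ = gen 4F ; S′ = gen 5F ; A = gen 6F
    forth = V ⊞ C ⊞ S′
    back  = U ⊞ C′ ⊞ S′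
    last  = V ⊞ C′ ⊞ S ⊞ A

    module _ (H : Group₀) where
      open AbelianGroup H
      open Evaluation H

      arc : ∀ (ℓ : Vertex M′ → Carrier) h t s {c c′ e e′} → c ≡ c′ → e ≡ e′ →
            ArcRelation {M′} H ℓ h t c s e → ArcRelation {M′} H ℓ h t c′ s e′
      arc ℓ h t s ≡.refl ≡.refl r = r

      arc′ : ∀ (ℓ : Vertex M → Carrier) h t c s {e e′} → e ≡ e′ →
             ArcRelation {M} H ℓ h t c s e → ArcRelation {M} H ℓ h t c s e′
      arc′ ℓ h t c s ≡.refl r = r

      atoms : (Vertex M′ → Carrier) → Fin 7 → Carrier
      atoms ℓ = ℓ (row (tail f)) ∷ ℓ (row (head f)) ∷ ℓ (column (suc (col f))) ∷ ℓ (symbol (suc (symb f))) ∷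
                ℓ (column zero) ∷ ℓ (symbol zero) ∷ j · (ℓ (row (head f)) - ℓ (row (tail f))) ∷ []

      restrict : ∀ ℓ → IsModel M′ H ℓ → IsModel M H (ℓ ∘ ι)
      restrict ℓ model b with b ≟ f
      ... | no b≢f     = arc ℓ (head b) (tail b) (suc (symb b)) (col-≢ b≢f) (excess-≢ b≢f) (model (suc (suc b)))
      ... | yes ≡.refl = arc′ (ℓ ∘ ι) (head f) (tail f) (col f) (symb f) (≡.sym f-excess)
        (linear-modulo (atoms ℓ) (forth ∷ back ∷ last ∷ [])
          (λ { 0F → trans (sym (identityʳ _)) (model 0F)
             ; 1F → trans (sym (identityʳ _)) (model 1F)
             ; 2F → arc ℓ (head f) (tail f) (suc (symb f)) col-f excess-f (model (suc (suc f))) })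
          -- `forth` minus `back` cancels the new symbol, and adding `last` cancels the new column.
          -- This leaves one copy of `V ⊞ ⊟ U` besides the `j` copies in `A`, hence the excess
          -- `suc j`.
          (gen 0F ⊞ ⊟ gen 1F ⊞ gen 2F)
          (V ⊞ C ⊞ S ⊞ ((V ⊞ ⊟ U) ⊞ A)) 𝟎 ≡.refl)

      -- Forced by the relations of the two plain arcs, each of which determines one new label. A
      -- model thus extends in exactly one way, and the group stays the same.
      newSymbol newColumn : (Vertex M → Carrier) → Carrier
      newSymbol ℓ = (ℓ (row (head f)) ∙ ℓ (column (col f))) ⁻¹
      newColumn ℓ = (ℓ (row (tail f)) ∙ newSymbol ℓ) ⁻¹

      extend : (Vertex M → Carrier) → Vertex M′ → Carrier
      extend ℓ (row r)          = ℓ (row r)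
      extend ℓ (column zero)    = newColumn ℓ
      extend ℓ (column (suc c)) = ℓ (column c)
      extend ℓ (symbol zero)    = newSymbol ℓ
      extend ℓ (symbol (suc s)) = ℓ (symbol s)

      extend-ι : ∀ ℓ v → extend ℓ (ι v) ≡ ℓ v
      extend-ι ℓ (row _)    = ≡.refl
      extend-ι ℓ (column _) = ≡.refl
      extend-ι ℓ (symbol _) = ≡.refl

      extend-model : ∀ ℓ → IsModel M H ℓ → IsModel M′ H (extend ℓ)
      extend-model ℓ model 0F = trans (identityʳ _)
        (linear (ℓ (row (head f)) ∷ ℓ (column (col f)) ∷ []) (gen 0F ⊞ gen 1F ⊞ ⊟ (gen 0F ⊞ gen 1F)) 𝟎 ≡.refl)
      extend-model ℓ model 1F = trans (identityʳ _)
        (linear (ℓ (row (tail f)) ∷ newSymbol ℓ ∷ []) (gen 0F ⊞ ⊟ (gen 0F ⊞ gen 1F) ⊞ gen 1F) 𝟎 ≡.refl)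
      extend-model ℓ model (suc (suc b)) with b ≟ f
      ... | no b≢f     = arc (extend ℓ) (head b) (tail b) (suc (symb b))
                           (≡.sym (col-≢ b≢f)) (≡.sym (excess-≢ b≢f)) (model b)
      ... | yes ≡.refl = arc (extend ℓ) (head f) (tail f) (suc (symb f)) (≡.sym col-f) (≡.sym excess-f) (trans
        (linear (ℓ (row (tail f)) ∷ ℓ (row (head f)) ∷ ℓ (column (col f)) ∷ ℓ (symbol (symb f)) ∷
                 j · (ℓ (row (head f)) - ℓ (row (tail f))) ∷ [])
          (gen 1F ⊞ ⊟ (gen 0F ⊞ ⊟ (gen 1F ⊞ gen 2F)) ⊞ gen 3F ⊞ gen 4F)
          (gen 1F ⊞ gen 2F ⊞ gen 3F ⊞ ((gen 1F ⊞ ⊟ gen 0F) ⊞ gen 4F)) ≡.refl)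
        (arc′ ℓ (head f) (tail f) (col f) (symb f) f-excess (model f)))

    module _ (H : Group₀) (ℓ : Vertex M′ → AbelianGroup.Carrier H) (model : IsModel M′ H ℓ) where
      open AbelianGroup H
      open Evaluation H

      ω : G.Carrier → Carrier
      ω x = eval ℓ (mapTerm ι (word x))

      ω-cong : ∀ {x y} → x G.≈ y → ω x ≈ ω y
      ω-cong {x} {y} e = trans (reflexive (eval-mapTerm ℓ ι (word x)))
        (trans (word-cong H (ℓ ∘ ι) (restrict H ℓ model) e) (reflexive (≡.sym (eval-mapTerm ℓ ι (word y)))))

      ω-homo : ∀ x y → ω (x G.∙ y) ≈ ω x ∙ ω y
      ω-homo x y = trans (reflexive (eval-mapTerm ℓ ι (word (x G.∙ y))))
        (trans (word-homo H (ℓ ∘ ι) (restrict H ℓ model) x y)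
          (sym (∙-cong (reflexive (eval-mapTerm ℓ ι (word x))) (reflexive (eval-mapTerm ℓ ι (word y))))))

      open Generation G H ω ω-cong ω-homo

      base : Vertex M′ → Carrier
      base v = eval ℓ (baseTerm M′ baseRow (suc baseColumn) v)

      base-ι : ∀ v → eval (ℓ ∘ ι) (baseTerm M baseRow baseColumn v) ≡ base (ι v)
      base-ι (row _)    = ≡.refl
      base-ι (column _) = ≡.refl
      base-ι (symbol _) = ≡.refl

      old : ∀ v → Generates (label v) (base (ι v)) (ℓ (ι v))
      old v = generates (trans (word-label H (ℓ ∘ ι) (restrict H ℓ model) v)
        (reflexive (cong₂ _∙_ (≡.sym (eval-mapTerm ℓ ι (word (label v)))) (base-ι v))))

      new-symbol : Generates (newSymbol G label) (base (symbol zero)) (ℓ (symbol zero))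
      new-symbol = generates-resp G.refl refl
        (linear-modulo (atoms H ℓ) (forth ∷ []) (λ { 0F → trans (sym (identityʳ _)) (model 0F) })
          (⊟ gen 0F) (⊟ (V ⊞ C)) (S′) ≡.refl)
        (generates-⁻¹ (generates-∙ (old (row (head f))) (old (column (col f)))))

      new-column : Generates (newColumn G label) (base (column zero)) (ℓ (column zero))
      new-column = generates-resp G.refl
        (linear (ℓ (row baseRow) ∷ ℓ (column (suc baseColumn)) ∷ [])
          (⊟ (gen 0F ⊞ ⊟ (gen 0F ⊞ gen 1F))) (gen 1F) ≡.refl)
        (linear-modulo (atoms H ℓ) (back ∷ []) (λ { 0F → trans (sym (identityʳ _)) (model 1F) })
          (⊟ gen 0F) (⊟ (U ⊞ S′)) (C′) ≡.refl)
        (generates-⁻¹ (generates-∙ (old (row (tail f))) new-symbol))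

      spanned : ∀ v → Generates (extend G label v) (base v) (ℓ v)
      spanned (row r)          = old (row r)
      spanned (column zero)    = new-column
      spanned (column (suc c)) = old (column c)
      spanned (symbol zero)    = new-symbol
      spanned (symbol (suc s)) = old (symbol s)

  unbundle-coordinates : Coordinates M′ G
  unbundle-coordinates = record
    { label       = extend G label
    ; label-model = extend-model G label label-model
    ; word        = mapTerm ι ∘ word
    ; baseRow     = baseRow
    ; baseColumn  = suc baseColumn
    ; word-cong   = ω-cong
    ; word-homo   = ω-homo
    ; word-label  = λ H ℓ model v → Generation.equation (spanned H ℓ model v)
    ; label-word  = λ x → G.trans (G.reflexive (EG.eval-mapTerm (extend G label) ι (word x)))
        (G.trans (EG.eval-cong (λ v → G.reflexive (extend-ι G label v)) (word x)) (label-word x))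
    ; exponent    = exponent
    }

-- Transport along homomorphisms, and divisibility

module _ (G H : Group₀) (f : AbelianGroup.Carrier G → AbelianGroup.Carrier H)
         (f-cong : ∀ {x y} → AbelianGroup._≈_ G x y → AbelianGroup._≈_ H (f x) (f y))
         (f-homo : ∀ x y → AbelianGroup._≈_ H (f (AbelianGroup._∙_ G x y)) (AbelianGroup._∙_ H (f x) (f y))) where
  private
    module G = AbelianGroup G
    module EG = Evaluation G
  open AbelianGroup H
  open Evaluation H

  eval-homo : ∀ {X : Set} (ρ : X → G.Carrier) t → f (EG.eval ρ t) ≈ eval (f ∘ ρ) t
  eval-homo ρ (gen x) = refl
  eval-homo ρ 𝟎       = homo-ε G H f f-cong f-homo
  eval-homo ρ (t ⊞ u) = trans (f-homo _ _) (∙-cong (eval-homo ρ t) (eval-homo ρ u))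
  eval-homo ρ (⊟ t)   = trans (homo-⁻¹ G H f f-cong f-homo _) (⁻¹-cong (eval-homo ρ t))

  homo-- : ∀ x y → f (x G.- y) ≈ f x - f y
  homo-- x y = trans (f-homo _ _) (∙-congˡ (homo-⁻¹ G H f f-cong f-homo y))

  model-homo : ∀ {M} ℓ → IsModel M G ℓ → IsModel M H (f ∘ ℓ)
  model-homo {M} ℓ model a = trans (sym (trans (f-homo _ _) (∙-cong
      (trans (f-homo _ _) (∙-congʳ (f-homo _ _)))
      (trans (homo-· G H f f-cong f-homo (excess a) _) (×-congʳ (excess a) (homo-- _ _))))))
    (trans (f-cong (model a)) (homo-ε G H f f-cong f-homo))
    where open Map M

module Divisibility {M : Map} {G : Group₀} (C : Coordinates M G) where
  open Coordinates C
  private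
    module G = AbelianGroup G
    module EG = Evaluation G

  Divides : ℕ → Fin (Map.nR M) → Fin (Map.nR M) → G.Carrier → Set
  Divides p r r′ g = p EG.· g G.≈ label (row r) G.- label (row r′)

  -- All rows have the same base term, so it cancels in the difference and divisibility in `G`
  -- carries over to every model.
  divides-word : ∀ {p r r′ g} → Divides p r r′ g → (H : Group₀) →
    let open AbelianGroup H
        open Evaluation H
    in ∀ ℓ → IsModel M H ℓ → p · eval ℓ (word g) ≈ ℓ (row r) - ℓ (row r′)
  divides-word {p} {r} {r′} {g} e H ℓ model = begin
    p · ω g                                               ≈⟨ homo-· G H ω ω-cong ω-homo p g ⟨
    ω (p EG.· g)                                          ≈⟨ ω-cong e ⟩
    ω (label (row r) G.- label (row r′))                  ≈⟨ homo-- G H ω ω-cong ω-homo _ _ ⟩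
    ω (label (row r)) - ω (label (row r′))
      ≈⟨ linear (ω (label (row r)) ∷ ω (label (row r′)) ∷ ℓ (row baseRow) ∷ [])
           (gen 0F ⊞ ⊟ gen 1F) ((gen 0F ⊞ gen 2F) ⊞ ⊟ (gen 1F ⊞ gen 2F)) ≡.refl ⟩
    (ω (label (row r)) ∙ ℓ (row baseRow)) - (ω (label (row r′)) ∙ ℓ (row baseRow))
      ≈⟨ ∙-cong (word-label H ℓ model (row r)) (⁻¹-cong (word-label H ℓ model (row r′))) ⟨
    ℓ (row r) - ℓ (row r′)                                ∎
    where
    open AbelianGroup H
    open Evaluation H
    open import Relation.Binary.Reasoning.Setoid setoid
    ω : G.Carrier → Carrier
    ω x = eval ℓ (word x)
    ω-cong : ∀ {x y} → x G.≈ y → ω x ≈ ω y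
    ω-cong = word-cong H ℓ model
    ω-homo : ∀ x y → ω (x G.∙ y) ≈ ω x ∙ ω y
    ω-homo = word-homo H ℓ model

-- Adjoining a cyclic summand

module Cyclic (d : ℕ) (G : Group₀) where
  private
    module G = AbelianGroup G
    module EG = Evaluation G
    module ℤd = AbelianGroup (ℤ/ d)
    module Eℤd = Evaluation (ℤ/ d)

  G′ : Group₀
  G′ = (ℤ/ d) ⊕ G

  open AbelianGroup G′
  open Evaluation G′

  η : Carrier
  η = ℤ.1ℤ , G.ε

  inj : G.Carrier → Carrier
  inj x = ℤ.0ℤ , x

  inj-cong : ∀ {x y} → x G.≈ y → inj x ≈ inj y
  inj-cong e = ℤd.refl , e

  inj-homo : ∀ x y → inj (x G.∙ y) ≈ inj x ∙ inj y
  inj-homo _ _ = refl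

  ·-η : ∀ n → n · η ≈ (ℤ.+ n , G.ε)
  ·-η zero    = refl
  ·-η (suc n) = trans (∙-congˡ {x = η} (·-η n)) (ℤd.refl , G.identityˡ _)

  ∗-η : ∀ i → i ∗ η ≈ (i , G.ε)
  ∗-η (ℤ.+ n)  = ·-η n
  ∗-η -[1+ n ] = trans (⁻¹-cong (·-η (suc n))) (ℤd.refl , AbelianGroupProperties.ε⁻¹≈ε G)

  d·η : d · η ≈ ε
  d·η = trans (·-η d) (congruent (divides ℤ.1ℤ
    (≡.trans (ℤ.+-identityʳ (ℤ.+ d)) (≡.sym (ℤ.*-identityˡ (ℤ.+ d))))) , G.refl)

  decompose : ∀ i x → i ∗ η ∙ inj x ≈ (i , x)
  decompose i x = trans (∙-congʳ (∗-η i)) (ℤd.reflexive (ℤ.+-identityʳ i) , G.identityˡ x)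

  ·-∗-comm : ∀ n i x → n · (i ∗ x) ≈ i ∗ (n · x)
  ·-∗-comm n (ℤ.+ m)  x = trans (×-assocˡ x n m) (trans (×-congˡ (ℕ.*-comm n m)) (sym (×-assocˡ x m n)))
  ·-∗-comm n -[1+ m ] x = trans (·-⁻¹ n (suc m · x)) (⁻¹-cong (·-∗-comm n (ℤ.+ suc m) x))

  exponent-⊕ : 1 ≤ d → (∃ λ e → 1 ≤ e × ∀ x → e EG.· x G.≈ G.ε) → ∃ λ e → 1 ≤ e × ∀ x → e · x ≈ ε
  exponent-⊕ 1≤d (e , 1≤e , kills) = e ℕ.* d , ℕ.*-mono-≤ 1≤e 1≤d , λ (i , x) →
    trans (×-congʳ (e ℕ.* d) (sym (decompose i x)))
      (trans (×-distrib-+ (i ∗ η) (inj x) (e ℕ.* d))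
        (trans (∙-cong
          (trans (sym (×-assocˡ (i ∗ η) e d))
            (trans (×-congʳ e (trans (·-∗-comm d i η) (trans (∗-cong i d·η) (∗-ε i)))) (·-ε e)))
          (trans (×-congˡ (ℕ.*-comm e d)) (trans (sym (×-assocˡ (inj x) d e))
            (trans (×-congʳ d (trans (sym (homo-· G G′ inj inj-cong inj-homo e x)) (inj-cong (kills x)))) (·-ε d)))))
        (identityˡ ε)))

module Extension {M M′ : Map} {G : Group₀} (C : Coordinates M G) (d : ℕ) (1≤d : 1 ≤ d)
  (ιR : Fin (Map.nR M) → Fin (Map.nR M′)) (ιC : Fin (Map.nC M) → Fin (Map.nC M′))
  (ιS : Fin (Map.nS M) → Fin (Map.nS M′)) where

  ι : Vertex M → Vertex M′
  ι (row r)    = row (ιR r)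
  ι (column c) = column (ιC c)
  ι (symbol s) = symbol (ιS s)

  open Coordinates C
  open Cyclic d G public
  private
    module G = AbelianGroup G
    module EG = Evaluation G
    module G′ = AbelianGroup G′
    module EG′ = Evaluation G′

  -- The new summand is generated by `y`: `y-order` makes its multiples well defined modulo `d` in
  -- every model, and `y-label` ensures that no smaller order occurs. It remains to show that `y`
  -- and the old words reach all new vertices.
  module Adjoin
    (restrict : ∀ H ℓ → IsModel M′ H ℓ → IsModel M H (ℓ ∘ ι))
    (y : Term (Vertex M′))
    (y-order : Annihilates M′ d y)
    (label′ : Vertex M′ → G′.Carrier) (label′-ι : ∀ v → label′ (ι v) G′.≈ inj (label v))
    (label′-model : IsModel M′ G′ label′)
    (y-label : EG′.eval label′ y G′.≈ η)
    where

    word′ : G′.Carrier → Term (Vertex M′)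
    word′ (i , x) = multiple i y ⊞ mapTerm ι (word x)

    module Words (H : Group₀) (ℓ : Vertex M′ → AbelianGroup.Carrier H) (model : IsModel M′ H ℓ) where
      open AbelianGroup H
      open Evaluation H

      private
        ω₀ : G.Carrier → Carrier
        ω₀ x = eval ℓ (mapTerm ι (word x))

        ω₀-cong : ∀ {x y} → x G.≈ y → ω₀ x ≈ ω₀ y
        ω₀-cong {x} {y} e = trans (reflexive (eval-mapTerm ℓ ι (word x)))
          (trans (word-cong H (ℓ ∘ ι) (restrict H ℓ model) e) (reflexive (≡.sym (eval-mapTerm ℓ ι (word y)))))

        ω₀-homo : ∀ x y → ω₀ (x G.∙ y) ≈ ω₀ x ∙ ω₀ y
        ω₀-homo x y = trans (reflexive (eval-mapTerm ℓ ι (word (x G.∙ y))))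
          (trans (word-homo H (ℓ ∘ ι) (restrict H ℓ model) x y)
            (sym (∙-cong (reflexive (eval-mapTerm ℓ ι (word x))) (reflexive (eval-mapTerm ℓ ι (word y))))))

      ω : G′.Carrier → Carrier
      ω x = eval ℓ (word′ x)

      private
        ω-split : ∀ i x → ω (i , x) ≈ i ∗ eval ℓ y ∙ ω₀ x
        ω-split i x = ∙-congʳ (reflexive (eval-multiple H ℓ i y))

      ω-cong : ∀ {x y} → x G′.≈ y → ω x ≈ ω y
      ω-cong {i , x} {j , x′} (e , e′) = trans (ω-split i x)
        (trans (∙-cong (∗-congruent {d} {eval ℓ y} (y-order H ℓ model) e) (ω₀-cong e′)) (sym (ω-split j x′)))

      ω-homo : ∀ x y → ω (x G′.∙ y) ≈ ω x ∙ ω y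
      ω-homo (i , x) (j , x′) = trans (ω-split (i ℤ.+ j) (x G.∙ x′))
        (trans (∙-cong (∗-homo-+ i j (eval ℓ y)) (ω₀-homo x x′))
          (trans (linear (i ∗ eval ℓ y ∷ j ∗ eval ℓ y ∷ ω₀ x ∷ ω₀ x′ ∷ [])
              (gen 0F ⊞ gen 1F ⊞ (gen 2F ⊞ gen 3F)) (gen 0F ⊞ gen 2F ⊞ (gen 1F ⊞ gen 3F)) ≡.refl)
            (sym (∙-cong (ω-split i x) (ω-split j x′)))))

      open Generation G′ H ω ω-cong ω-homo public

      base : Vertex M′ → Carrier
      base v = eval ℓ (baseTerm M′ (ιR baseRow) (ιC baseColumn) v)

      generates-word : ∀ x → Generates (inj x) ε (ω₀ x)
      generates-word x = generates (sym (trans (identityʳ _) (identityˡ _)))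

      generates-y : Generates η ε (eval ℓ y)
      generates-y = generates
        (sym (trans (identityʳ _) (trans (∙-cong (identityʳ _) (homo-ε G H ω₀ ω₀-cong ω₀-homo)) (identityʳ _))))

      generates-ι : ∀ v → Generates (label′ (ι v)) (base (ι v)) (ℓ (ι v))
      generates-ι v = generates (trans (word-label H (ℓ ∘ ι) (restrict H ℓ model) v) (∙-cong
        (trans (reflexive (≡.sym (eval-mapTerm ℓ ι (word (label v)))))
          (trans (trans (equation (generates-word (label v))) (identityʳ _)) (ω-cong (G′.sym (label′-ι v)))))
        (reflexive (base-ι v))))
        where
        base-ι : ∀ v → eval (ℓ ∘ ι) (baseTerm M baseRow baseColumn v) ≡ base (ι v)
        base-ι (row _)    = ≡.refl
        base-ι (column _) = ≡.refl
        base-ι (symbol _) = ≡.refl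

    adjoin : (∀ H ℓ model → let open Words H ℓ model in ∀ v → Generates (label′ v) (base v) (ℓ v)) →
             Coordinates M′ G′
    adjoin spanned = record
      { label       = label′
      ; label-model = label′-model
      ; word        = word′
      ; baseRow     = ιR baseRow
      ; baseColumn  = ιC baseColumn
      ; word-cong   = Words.ω-cong
      ; word-homo   = Words.ω-homo
      ; word-label  = λ H ℓ model v → Words.equation (spanned H ℓ model v)
      ; label-word  = λ (i , x) → G′.trans
          (G′.∙-cong
            (G′.trans (G′.reflexive (eval-multiple G′ label′ i y)) (EG′.∗-cong i y-label))
            (G′.trans (G′.reflexive (EG′.eval-mapTerm label′ ι (word x)))
              (G′.trans (EG′.eval-cong label′-ι (word x))
                (G′.trans (G′.sym (eval-homo G G′ inj inj-cong inj-homo label (word x))) (inj-cong (label-word x))))))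
          (decompose i x)
      ; exponent    = exponent-⊕ 1≤d exponent
      }

  module Bead (z : Fin (Map.nR M′)) (t : Fin (Map.nR M)) (g : G.Carrier)
    (restrict : ∀ H ℓ → IsModel M′ H ℓ → IsModel M H (ℓ ∘ ι)) where

    -- This is where divisibility is needed. The relations express `p` times the difference of `z`
    -- and `t` through the difference of `h` and `t`; since the latter is `p` times `g`, subtracting
    -- `g` removes it, and the extension of `G` splits.
    y : Term (Vertex M′)
    y = gen (row z) ⊞ ⊟ gen (row (ιR t)) ⊞ ⊟ mapTerm ι (word g)

    multiple-y : (H : Group₀) →
      let open AbelianGroup H
          open Evaluation H
      in ∀ ℓ → IsModel M′ H ℓ → ∀ p {h} → Divisibility.Divides C p h t g →
                 p · eval ℓ y ≈ p · (ℓ (row z) - ℓ (row (ιR t))) - (ℓ (row (ιR h)) - ℓ (row (ιR t)))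
    multiple-y H ℓ model p {h} e = trans (×-distrib-+ _ _ p) (∙-congˡ (trans (·-⁻¹ p _) (⁻¹-cong
        (trans (×-congʳ p (reflexive (eval-mapTerm ℓ ι (word g))))
          (Divisibility.divides-word C {p} {h} {t} {g} e H (ℓ ∘ ι) (restrict H ℓ model))))))
      where
      open AbelianGroup H
      open Evaluation H

    module _
      (label′ : Vertex M′ → G′.Carrier) (label′-ι : ∀ v → label′ (ι v) G′.≈ inj (label v))
      (label′-model : IsModel M′ G′ label′)
      (label′-z : label′ (row z) G′.≈ inj (label (row t) G.∙ g) G′.∙ η)
      (y-order : Annihilates M′ d y) where

      private
        y-label : EG′.eval label′ y G′.≈ η
        y-label = G′.trans
          (G′.∙-cong (G′.∙-cong (G′.trans label′-z (G′.∙-congʳ {x = η} (inj-homo (label (row t)) g)))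
              (G′.⁻¹-cong (label′-ι (row t))))
            (G′.⁻¹-cong (G′.trans (G′.reflexive (EG′.eval-mapTerm label′ ι (word g)))
              (G′.trans (EG′.eval-cong label′-ι (word g))
                (G′.trans (G′.sym (eval-homo G G′ inj inj-cong inj-homo label (word g))) (inj-cong (label-word g)))))))
          (EG′.linear (inj (label (row t)) ∷ inj g ∷ η ∷ [])
            ((gen 0F ⊞ gen 1F ⊞ gen 2F) ⊞ ⊟ gen 0F ⊞ ⊟ gen 1F) (gen 2F) ≡.refl)

      open Adjoin restrict y y-order label′ label′-ι label′-model y-label public

      generates-z : ∀ H ℓ model → let open Words H ℓ model in
                    Generates (label′ (row z)) (base (row z)) (ℓ (row z))
      generates-z H ℓ model = generates-resp
        (G′.trans (EG′.linear (η ∷ label′ (row (ιR t)) ∷ inj g ∷ [])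
            (gen 0F ⊞ gen 1F ⊞ gen 2F) (gen 1F ⊞ gen 2F ⊞ gen 0F) ≡.refl)
          (G′.trans (G′.∙-congʳ (G′.∙-congʳ (label′-ι (row t))))
            (G′.sym (G′.trans label′-z (G′.∙-congʳ {x = η} (inj-homo (label (row t)) g))))))
        (trans (identityʳ _) (identityˡ _))
        (linear (ℓ (row z) ∷ ℓ (row (ιR t)) ∷ eval ℓ (mapTerm ι (word g)) ∷ [])
          ((gen 0F ⊞ ⊟ gen 1F ⊞ ⊟ gen 2F) ⊞ gen 1F ⊞ gen 2F) (gen 0F) ≡.refl)
        (generates-∙ (generates-∙ generates-y (generates-ι (row t))) (generates-word g))
        where
        open AbelianGroup H
        open Evaluation H
        open Words H ℓ model

-- The summand ℤ/p

module SubdivisionCoordinates (M : Map) (x : Fin (Map.nA M)) (x-plain : Map.excess M x ≡ 0) (q : ℕ)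
  (G : Group₀) (C : Coordinates M G) (g : AbelianGroup.Carrier G)
  (g-divides : Divisibility.Divides C (suc (suc q)) (Map.head M x) (Map.tail M x) g) where
  open Map M
  open Coordinates C
  open Subdivision M x (suc q) 0 using (tail-x; tail-≢; excess-x; excess-≢)

  private
    -- Excess `p − 1` on the first half gives `p` arcs to the new vertex and `p − 1` back; the
    -- second half stays plain.
    M′ = subdivide M x (suc q) 0

    p : ℕ
    p = suc (suc q)

    module G = AbelianGroup G
    module EG = Evaluation G

  open Extension {M} {M′} C p (s≤s z≤n) Fin.suc id id

  private
    module G′ = AbelianGroup G′
    module EG′ = Evaluation G′

    module _ (H : Group₀) (ℓ : Vertex M′ → AbelianGroup.Carrier H) where
      open AbelianGroup H
      open Evaluation H

      arc : ∀ h c s {t t′ e e′} → t ≡ t′ → e ≡ e′ →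
            ArcRelation {M′} H ℓ h t c s e → ArcRelation {M′} H ℓ h t′ c s e′
      arc h c s ≡.refl ≡.refl r = r

      restrict : IsModel M′ H ℓ → IsModel M H (ℓ ∘ ι)
      restrict model a with a ≟ x
      ... | no a≢x     = arc (suc (head a)) (col a) (symb a) (tail-≢ a≢x) (excess-≢ a≢x) (model (suc a))
      ... | yes ≡.refl = trans (∙-zero-· _ _ x-plain) (trans (sym (∙-zero-· _ _ excess-x)) (model (suc x)))

      extend-model : IsModel M H (ℓ ∘ ι) →
        ArcRelation {M′} H ℓ zero (suc (tail x)) (col x) (symb x) (suc q) → IsModel M′ H ℓ
      extend-model model r zero = r
      extend-model model r (suc a) with a ≟ x
      ... | no a≢x     = arc (suc (head a)) (col a) (symb a) (≡.sym (tail-≢ a≢x)) (≡.sym (excess-≢ a≢x)) (model a)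
      ... | yes ≡.refl = trans (∙-zero-· _ _ excess-x) (trans (sym (∙-zero-· _ _ x-plain)) (model x))

    open Bead zero (tail x) g restrict

    label′ : Vertex M′ → G′.Carrier
    label′ (row zero)    = inj (label (row (tail x)) G.∙ g) G′.∙ η
    label′ (row (suc r)) = inj (label (row r))
    label′ (column c)    = inj (label (column c))
    label′ (symbol s)    = inj (label (symbol s))

    label′-ι : ∀ v → label′ (ι v) ≡ inj (label v)
    label′-ι (row _)    = ≡.refl
    label′-ι (column _) = ≡.refl
    label′-ι (symbol _) = ≡.refl

    p·inj : p EG′.· inj g G′.≈ inj (label (row (head x))) G′.- inj (label (row (tail x)))
    p·inj = G′.trans (G′.sym (homo-· G G′ inj inj-cong inj-homo p g))
      (G′.trans (inj-cong g-divides) (homo-- G G′ inj inj-cong inj-homo _ _))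

    p·bead : p EG′.· (label′ (row zero) G′.- inj (label (row (tail x)))) G′.≈
             inj (label (row (head x))) G′.- inj (label (row (tail x)))
    p·bead = G′.trans
      (EG′.×-congʳ p (EG′.linear (inj (label (row (tail x))) ∷ inj g ∷ η ∷ [])
        (gen 0F ⊞ gen 1F ⊞ gen 2F ⊞ ⊟ gen 0F) (gen 1F ⊞ gen 2F) ≡.refl))
      (G′.trans (EG′.×-distrib-+ (inj g) η p) (G′.trans (G′.∙-cong p·inj d·η) (G′.identityʳ _)))

    label′-model : IsModel M′ G′ label′
    label′-model = extend-model G′ label′ lifted
      (EG′.linear-modulo (label′ (row zero) ∷ inj (label (row (tail x))) ∷ inj (label (row (head x))) ∷
          label′ (column (col x)) ∷ label′ (symbol (symb x)) ∷
          suc q EG′.· (label′ (row zero) G′.- inj (label (row (tail x)))) ∷ [])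
        ((((gen 0F ⊞ ⊟ gen 1F) ⊞ gen 5F) ⊞ ⊟ (gen 2F ⊞ ⊟ gen 1F)) ∷ (gen 2F ⊞ gen 3F ⊞ gen 4F) ∷ [])
        (λ { 0F → AbelianGroupProperties.x≈y⇒x∙y⁻¹≈ε G′ p·bead
           ; 1F → G′.trans (G′.sym (EG′.∙-zero-· _ _ x-plain)) (lifted x) })
        (gen 0F ⊞ gen 1F)
        (gen 0F ⊞ gen 3F ⊞ gen 4F ⊞ gen 5F) 𝟎 ≡.refl)
      where
      lifted : IsModel M G′ (label′ ∘ ι)
      lifted a = G′.trans (G′.reflexive (cong₂ G′._∙_
          (cong₂ G′._∙_ (cong₂ G′._∙_ (label′-ι _) (label′-ι _)) (label′-ι _))
          (cong (excess a EG′.·_) (cong₂ G′._-_ (label′-ι (row (head a))) (label′-ι (row (tail a)))))))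
        (model-homo G G′ inj inj-cong inj-homo {M} label label-model a)

    y-order : Annihilates M′ p y
    y-order H ℓ model = trans (multiple-y H ℓ model p g-divides)
      (linear-modulo (ℓ (row zero) ∷ ℓ (row (suc (tail x))) ∷ ℓ (row (suc (head x))) ∷
          ℓ (column (col x)) ∷ ℓ (symbol (symb x)) ∷ suc q · (ℓ (row zero) - ℓ (row (suc (tail x)))) ∷ [])
        ((gen 0F ⊞ gen 3F ⊞ gen 4F ⊞ gen 5F) ∷ (gen 2F ⊞ gen 3F ⊞ gen 4F) ∷ [])
        (λ { 0F → model zero ; 1F → trans (sym (∙-zero-· _ _ excess-x)) (model (suc x)) })
        -- The halves of `x` share both faces, so column and symbol cancel in the difference of
        -- their relations. The extra copy of the new row turns the multiple `suc q` into `p`.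
        (gen 0F ⊞ ⊟ gen 1F)
        (((gen 0F ⊞ ⊟ gen 1F) ⊞ gen 5F) ⊞ ⊟ (gen 2F ⊞ ⊟ gen 1F)) 𝟎 ≡.refl)
      where
      open AbelianGroup H
      open Evaluation H

    ι-label : ∀ v → label′ (ι v) G′.≈ inj (label v)
    ι-label v = G′.reflexive (label′-ι v)

    module _ (H : Group₀) (ℓ : Vertex M′ → AbelianGroup.Carrier H) (model : IsModel M′ H ℓ) where
      open Words label′ ι-label label′-model G′.refl y-order H ℓ model

      spanned : ∀ v → Generates (label′ v) (base v) (ℓ v)
      spanned (row zero)    = generates-z label′ ι-label label′-model G′.refl y-order H ℓ model
      spanned (row (suc r)) = generates-ι (row r)
      spanned (column c)    = generates-ι (column c)
      spanned (symbol s)    = generates-ι (symbol s)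

  subdivide-coordinates : Coordinates M′ G′
  subdivide-coordinates = adjoin label′ ι-label label′-model G′.refl y-order spanned

module _ (M : Map) (x : Fin (Map.nA M)) (q r : ℕ) where

  -- With x from w to w′, the new vertices are z, joined to w by a bundle of p arcs
  -- and p − 1 reversed ones, and v, on one of the reversed arcs; the remaining part
  -- of that arc is a bundle of a arcs from v to w.  Here p = q + 2 and a = r + 2.
  petal : Map
  petal = subdivide (unbundle (subdivide M x (suc q) 0) 0F q) 1F 0 (suc r)

-- The summand ℤ/pa

module PetalCoordinates (M : Map) (x : Fin (Map.nA M)) (x-plain : Map.excess M x ≡ 0) (q r : ℕ)
  (G : Group₀) (C : Coordinates M G) (g : AbelianGroup.Carrier G)
  (g-divides : Divisibility.Divides C (suc (suc q)) (Map.head M x) (Map.tail M x) g) where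
  open Map M
  open Coordinates C
  open Subdivision M x (suc q) 0 using (tail-x; tail-≢; excess-x; excess-≢)

  private
    M′ = petal M x q r

    p a : ℕ
    p = suc (suc q)
    a = suc (suc r)

    module G = AbelianGroup G
    module EG = Evaluation G

  open Extension {M} {M′} C (p ℕ.* a) (s≤s z≤n) (Fin.suc ∘ Fin.suc) Fin.suc Fin.suc

  private
    module G′ = AbelianGroup G′
    module EG′ = Evaluation G′

    pattern v = zero
    pattern z = suc zero

    w h : Fin (Map.nR M′)
    w = suc (suc (tail x))
    h = suc (suc (head x))

    c : Fin (Map.nC M′)
    c = suc (col x)

    s : Fin (Map.nS M′)
    s = suc (symb x)

    -- A and D are the multiples of Z − W and W − V in the relations of the two
    -- bundles.
    W H V Z C₀ S C′ S′ A D : Term (Fin 10)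
    W = gen 0F ; H = gen 1F ; V = gen 2F ; Z = gen 3F ; C₀ = gen 4F
    S = gen 5F ; C′ = gen 6F ; S′ = gen 7F ; A = gen 8F ; D = gen 9F

    module _ (K : Group₀) (ℓ : Vertex M′ → AbelianGroup.Carrier K) where
      open AbelianGroup K
      open Evaluation K

      arc : ∀ h c s {t t′ e e′} → t ≡ t′ → e ≡ e′ →
            ArcRelation {M′} K ℓ h t c s e → ArcRelation {M′} K ℓ h t′ c s e′
      arc h c s ≡.refl ≡.refl r = r

      restrict : IsModel M′ K ℓ → IsModel M K (ℓ ∘ ι)
      restrict model b with b ≟ x
      ... | no b≢x     = arc (suc (suc (head b))) (suc (col b)) (suc (symb b))
                           (cong suc (tail-≢ b≢x)) (excess-≢ b≢x) (model (suc (suc (suc (suc b)))))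
      ... | yes ≡.refl = trans (∙-zero-· _ _ x-plain)
                           (trans (sym (∙-zero-· _ _ excess-x)) (model (suc (suc (suc (suc x))))))

      extend-model : IsModel M K (ℓ ∘ ι) →
        ArcRelation {M′} K ℓ v z zero zero 0 → ArcRelation {M′} K ℓ z w c zero 0 →
        ArcRelation {M′} K ℓ w v zero zero (suc r) → ArcRelation {M′} K ℓ z w zero s q → IsModel M′ K ℓ
      extend-model model r₀ r₁ r₂ r₃ 0F = r₀
      extend-model model r₀ r₁ r₂ r₃ 1F = r₁
      extend-model model r₀ r₁ r₂ r₃ 2F = r₂
      extend-model model r₀ r₁ r₂ r₃ 3F = r₃
      extend-model model r₀ r₁ r₂ r₃ (suc (suc (suc (suc b)))) with b ≟ x
      ... | no b≢x     = arc (suc (suc (head b))) (suc (col b)) (suc (symb b))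
                           (cong suc (≡.sym (tail-≢ b≢x))) (≡.sym (excess-≢ b≢x)) (model b)
      ... | yes ≡.refl = trans (∙-zero-· _ _ excess-x) (trans (sym (∙-zero-· _ _ x-plain)) (model x))

      atoms : Fin 10 → Carrier
      atoms = ℓ (row w) ∷ ℓ (row h) ∷ ℓ (row v) ∷ ℓ (row z) ∷ ℓ (column c) ∷ ℓ (symbol s) ∷
              ℓ (column zero) ∷ ℓ (symbol zero) ∷
              q · (ℓ (row z) - ℓ (row w)) ∷ suc r · (ℓ (row w) - ℓ (row v)) ∷ []

    -- In order: the second half of `x`, the arc from `z` to `v`, the plain arc from `w` to `z`, the
    -- bundle from `v` to `w`, and the rest of the bundle from `w` to `z`.
    relations : Fin 5 → Term (Fin 10)
    relations = (H ⊞ C₀ ⊞ S) ∷ (V ⊞ C′ ⊞ S′) ∷ (Z ⊞ C₀ ⊞ S′) ∷ (W ⊞ C′ ⊞ S′ ⊞ D) ∷ (Z ⊞ C′ ⊞ S ⊞ A) ∷ []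

    hold : (K : Group₀) →
      let open AbelianGroup K
          open Evaluation K
      in ∀ ℓ → IsModel M′ K ℓ → ∀ i → eval (atoms K ℓ) (relations i) ≈ ε
    hold K ℓ model = λ
      { 0F → trans (sym (∙-zero-· _ _ excess-x)) (model (suc (suc (suc (suc x)))))
      ; 1F → trans (sym (identityʳ _)) (model 0F)
      ; 2F → trans (sym (identityʳ _)) (model 1F)
      ; 3F → model 2F
      ; 4F → model 3F
      }
      where
      open AbelianGroup K
      open Evaluation K

    open Bead z (tail x) g restrict

    -- All faces cancel when the relations of `x` and of the arc into `v` are subtracted from those
    -- of the two arcs into `z`. The part that comes from `h` is removed by `g` inside `y`.
    multiple-y-p : (K : Group₀) →
      let open AbelianGroup K
          open Evaluation K
      in ∀ ℓ → IsModel M′ K ℓ → p · eval ℓ y ≈ ℓ (row v) - ℓ (row w)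
    multiple-y-p K ℓ model = trans (multiple-y K ℓ model p g-divides)
      (linear-modulo (atoms K ℓ) relations (hold K ℓ model)
        (⊟ gen 0F ⊞ ⊟ gen 1F ⊞ gen 2F ⊞ gen 4F)
        (((Z ⊞ ⊟ W) ⊞ ((Z ⊞ ⊟ W) ⊞ A)) ⊞ ⊟ (H ⊞ ⊟ W)) (V ⊞ ⊟ W) ≡.refl)
      where
      open AbelianGroup K
      open Evaluation K

    y-order : Annihilates M′ (p ℕ.* a) y
    y-order K ℓ model = begin
      (p ℕ.* a) · Y                    ≈⟨ ×-congˡ (ℕ.*-comm p a) ⟩
      (a ℕ.* p) · Y                    ≈⟨ ×-assocˡ Y a p ⟨
      a · (p · Y)                      ≈⟨ ×-congʳ a (multiple-y-p K ℓ model) ⟩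
      a · (ℓ (row v) - ℓ (row w))      ≈⟨ ×-congʳ a (linear (ℓ (row v) ∷ ℓ (row w) ∷ [])
                                            (gen 0F ⊞ ⊟ gen 1F) (⊟ (gen 1F ⊞ ⊟ gen 0F)) ≡.refl) ⟩
      a · ((ℓ (row w) - ℓ (row v)) ⁻¹) ≈⟨ ·-⁻¹ a _ ⟩
      -- The arc into `v` and the bundle out of it share both faces; subtracting their relations
      -- leaves `a` copies of `w` minus `v`.
      (a · (ℓ (row w) - ℓ (row v))) ⁻¹ ≈⟨ linear-modulo (atoms K ℓ) relations (hold K ℓ model)
                                            (gen 1F ⊞ ⊟ gen 3F) (⊟ ((W ⊞ ⊟ V) ⊞ D)) 𝟎 ≡.refl ⟩
      ε                                ∎
      where
      open AbelianGroup K
      open Evaluation K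
      open import Relation.Binary.Reasoning.Setoid setoid
      Y = eval ℓ y

    newSymbol newColumn : G′.Carrier
    newSymbol = ((inj (label (row (tail x)) G.∙ g) G′.∙ η) G′.∙ inj (label (column (col x)))) G′.⁻¹
    newColumn = ((inj (label (row (tail x))) G′.∙ p EG′.· η) G′.∙ newSymbol) G′.⁻¹

    -- The label of `v` is dictated by `multiple-y-p`, as `y` must go to `η`; the new symbol and
    -- column are then forced by the two plain arcs at `z`.
    label′ : Vertex M′ → G′.Carrier
    label′ (row v)             = inj (label (row (tail x))) G′.∙ p EG′.· η
    label′ (row z)             = inj (label (row (tail x)) G.∙ g) G′.∙ η
    label′ (row (suc (suc t))) = inj (label (row t))
    label′ (column zero)       = newColumn
    label′ (column (suc c))    = inj (label (column c))
    label′ (symbol zero)       = newSymbol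
    label′ (symbol (suc s))    = inj (label (symbol s))

    label′-ι : ∀ u → label′ (ι u) ≡ inj (label u)
    label′-ι (row _)    = ≡.refl
    label′-ι (column _) = ≡.refl
    label′-ι (symbol _) = ≡.refl

    ι-label : ∀ u → label′ (ι u) G′.≈ inj (label u)
    ι-label u = G′.reflexive (label′-ι u)

    p·inj : p EG′.· inj g G′.≈ label′ (row h) G′.- label′ (row w)
    p·inj = G′.trans (G′.sym (homo-· G G′ inj inj-cong inj-homo p g))
      (G′.trans (inj-cong g-divides) (homo-- G G′ inj inj-cong inj-homo _ _))

    p·bead : p EG′.· (label′ (row z) G′.- label′ (row w)) G′.≈
             (label′ (row h) G′.- label′ (row w)) G′.∙ p EG′.· η
    p·bead = G′.trans
      (EG′.×-congʳ p (EG′.linear (inj (label (row (tail x))) ∷ inj g ∷ η ∷ [])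
        (gen 0F ⊞ gen 1F ⊞ gen 2F ⊞ ⊟ gen 0F) (gen 1F ⊞ gen 2F) ≡.refl))
      (G′.trans (EG′.×-distrib-+ (inj g) η p) (G′.∙-congʳ {x = p EG′.· η} p·inj))

    a·tip : a EG′.· (label′ (row w) G′.- label′ (row v)) G′.≈ G′.ε
    a·tip = G′.trans (EG′.×-congʳ a (EG′.linear (label′ (row w) ∷ p EG′.· η ∷ [])
        (gen 0F ⊞ ⊟ (gen 0F ⊞ gen 1F)) (⊟ gen 1F) ≡.refl))
      (G′.trans (EG′.·-⁻¹ a (p EG′.· η)) (G′.trans (G′.⁻¹-cong
        (G′.trans (EG′.×-assocˡ η a p) (G′.trans (EG′.×-congˡ {x = η} (ℕ.*-comm a p)) d·η)))
        (AbelianGroupProperties.ε⁻¹≈ε G′)))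

    label′-model : IsModel M′ G′ label′
    label′-model = extend-model G′ label′ lifted
      (G′.trans (G′.identityʳ _) (EG′.linear (label′ (row v) ∷ newSymbol ∷ [])
        (gen 0F ⊞ ⊟ (gen 0F ⊞ gen 1F) ⊞ gen 1F) 𝟎 ≡.refl))
      (G′.trans (G′.identityʳ _) (EG′.linear (label′ (row z) ∷ label′ (column c) ∷ [])
        (gen 0F ⊞ gen 1F ⊞ ⊟ (gen 0F ⊞ gen 1F)) 𝟎 ≡.refl))
      (EG′.linear-modulo (label′ (row w) ∷ label′ (row v) ∷ newSymbol ∷
          suc r EG′.· (label′ (row w) G′.- label′ (row v)) ∷ [])
        (((gen 0F ⊞ ⊟ gen 1F) ⊞ gen 3F) ∷ []) (λ { 0F → a·tip }) (gen 0F)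
        (gen 0F ⊞ ⊟ (gen 1F ⊞ gen 2F) ⊞ gen 2F ⊞ gen 3F) 𝟎 ≡.refl)
      (EG′.linear-modulo (label′ (row w) ∷ label′ (row h) ∷ label′ (row z) ∷ label′ (column c) ∷ label′ (symbol s) ∷
          p EG′.· η ∷ q EG′.· (label′ (row z) G′.- label′ (row w)) ∷ [])
        ((((gen 2F ⊞ ⊟ gen 0F) ⊞ ((gen 2F ⊞ ⊟ gen 0F) ⊞ gen 6F)) ⊞ ⊟ ((gen 1F ⊞ ⊟ gen 0F) ⊞ gen 5F)) ∷
          (gen 1F ⊞ gen 3F ⊞ gen 4F) ∷ [])
        (λ { 0F → AbelianGroupProperties.x≈y⇒x∙y⁻¹≈ε G′ p·bead
           ; 1F → G′.trans (G′.sym (EG′.∙-zero-· _ _ x-plain)) (lifted x) })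
        (gen 0F ⊞ gen 1F)
        (gen 2F ⊞ ⊟ ((gen 0F ⊞ gen 5F) ⊞ ⊟ (gen 2F ⊞ gen 3F)) ⊞ gen 4F ⊞ gen 6F) 𝟎 ≡.refl)
      where
      lifted : IsModel M G′ (label′ ∘ ι)
      lifted b = G′.trans (G′.reflexive (cong₂ G′._∙_
          (cong₂ G′._∙_ (cong₂ G′._∙_ (label′-ι (row (head b))) (label′-ι (column (col b))))
            (label′-ι (symbol (symb b))))
          (cong (excess b EG′.·_) (cong₂ G′._-_ (label′-ι (row (head b))) (label′-ι (row (tail b)))))))
        (model-homo G G′ inj inj-cong inj-homo {M} label label-model b)

    module _ (K : Group₀) (ℓ : Vertex M′ → AbelianGroup.Carrier K) (model : IsModel M′ K ℓ) where
      open AbelianGroup K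
      open Evaluation K
      open Words label′ ι-label label′-model G′.refl y-order K ℓ model

      span-z : Generates (label′ (row z)) (base (row z)) (ℓ (row z))
      span-z = generates-z label′ ι-label label′-model G′.refl y-order K ℓ model

      span-v : Generates (label′ (row v)) (base (row v)) (ℓ (row v))
      span-v = generates-resp G′.refl (identityʳ _)
        (trans (∙-congˡ (multiple-y-p K ℓ model))
          (linear (ℓ (row w) ∷ ℓ (row v) ∷ []) (gen 0F ⊞ (gen 1F ⊞ ⊟ gen 0F)) (gen 1F) ≡.refl))
        (generates-∙ (generates-ι (row (tail x))) (generates-· p generates-y))

      span-symbol : Generates newSymbol (base (symbol zero)) (ℓ (symbol zero))
      span-symbol = generates-resp G′.refl refl
        (linear-modulo (atoms K ℓ) relations (hold K ℓ model) (⊟ gen 2F) (⊟ (Z ⊞ C₀)) S′ ≡.refl)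
        (generates-⁻¹ (generates-∙ span-z (generates-ι (column (col x)))))

      span-column : Generates newColumn (base (column zero)) (ℓ (column zero))
      span-column = generates-resp G′.refl
        (linear (base (row v) ∷ base (column zero) ∷ []) (⊟ (gen 0F ⊞ ⊟ (gen 0F ⊞ gen 1F))) (gen 1F) ≡.refl)
        (linear-modulo (atoms K ℓ) relations (hold K ℓ model) (⊟ gen 1F) (⊟ (V ⊞ S′)) C′ ≡.refl)
        (generates-⁻¹ (generates-∙ span-v span-symbol))

      spanned : ∀ u → Generates (label′ u) (base u) (ℓ u)
      spanned (row v)             = span-v
      spanned (row z)             = span-z
      spanned (row (suc (suc t))) = generates-ι (row t)
      spanned (column zero)       = span-column
      spanned (column (suc c))    = generates-ι (column c)
      spanned (symbol zero)       = span-symbol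
      spanned (symbol (suc s))    = generates-ι (symbol s)

  petal-coordinates : Coordinates M′ G′
  petal-coordinates = adjoin label′ ι-label label′-model G′.refl y-order spanned

-- The construction

-- The spare arcs are those along which the difference of labels is divisible by p.

record Stage (p : ℕ) (G : Group₀) (m : ℕ) : Set₁ where
  field
    map         : Map
    spherical   : Spherical map
    coordinates : Coordinates map G

  open Map map public
  open Divisibility coordinates public

  field
    spare           : Fin m → Fin nA
    spare-injective : ∀ {i j} → spare i ≡ spare j → i ≡ j
    spare-plain     : ∀ i → excess (spare i) ≡ 0
    spare-divides   : ∀ i → ∃ (Divides p (head (spare i)) (tail (spare i)))

-- Kept apart from `Stage` because the initial map consists of a loop.
Stage⁺ : ℕ → Group₀ → ℕ → Set₁
Stage⁺ p G m = Σ (Stage p G m) (Loopless ∘ Stage.map)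

module _ {M : Map} {G : Group₀} (C : Coordinates M G) where
  open Divisibility C
  open AbelianGroup G
  open Evaluation G

  divides-flip : ∀ {p r r′ g} → Divides p r r′ g → Divides p r′ r (g ⁻¹)
  divides-flip {p} e = trans (·-⁻¹ p _) (trans (⁻¹-cong e) (AbelianGroupProperties.⁻¹-anti-homo‿- G _ _))

-- All arcs of a bundle join the same two rows, so divisibility passes to each of them, with a sign
-- for the reversed ones. Every opening yields two plain spare arcs, and the plain arc left at the
-- end is one more.
unbundleSpare : ∀ {p G m} (S : Stage⁺ p G m) → let open Stage (proj₁ S) in
                ∀ h j → excess h ≡ j → (∀ i → spare i ≢ h) → ∃ (Divides p (head h) (tail h)) →
                Stage⁺ p G (2 * j + suc m)
unbundleSpare (S , loopless) h zero h-plain fresh h-divides = record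
  { map             = map
  ; spherical       = spherical
  ; coordinates     = coordinates
  ; spare           = h ∷ spare
  ; spare-injective = λ
    { {zero}  {zero}  _ → ≡.refl
    ; {zero}  {suc j} e → contradiction (≡.sym e) (fresh j)
    ; {suc i} {zero}  e → contradiction e (fresh i)
    ; {suc i} {suc j} e → cong suc (spare-injective e)
    }
  ; spare-plain     = λ { zero → h-plain ; (suc i) → spare-plain i }
  ; spare-divides   = λ { zero → h-divides ; (suc i) → spare-divides i }
  } , loopless
  where open Stage S
unbundleSpare {p} {G} {m} (S , loopless) h (suc j) h-excess fresh (g , g-divides) =
  ≡.subst (Stage⁺ p G) (arith j m)
    (unbundleSpare {p} {G} {2 + m} (S′ , unbundle-loopless map h j loopless) (suc (suc h)) j
      excess-f fresh′ (g , g-divides))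
  where
  open Stage S
  open Unbundling map h j using (excess-f; excess-≢)

  arith : ∀ j m → 2 * j + suc (2 + m) ≡ 2 * suc j + suc m
  arith = ℕSolver.solve-∀

  spare′ : Fin (2 + m) → Fin (2 + nA)
  spare′ zero          = zero
  spare′ (suc zero)    = suc zero
  spare′ (suc (suc i)) = suc (suc (spare i))

  fresh′ : ∀ i → spare′ i ≢ suc (suc h)
  fresh′ zero          ()
  fresh′ (suc zero)    ()
  fresh′ (suc (suc i)) e = fresh i (suc-injective (suc-injective e))

  S′ : Stage p G (2 + m)
  S′ = record
    { map             = unbundle map h j
    ; spherical       = unbundle-spherical map h j spherical (loopless h)
    ; coordinates     = UnbundlingCoordinates.unbundle-coordinates map h j h-excess G coordinates
    ; spare           = spare′
    ; spare-injective = λ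
      { {zero}        {zero}        _ → ≡.refl
      ; {suc zero}    {suc zero}    _ → ≡.refl
      ; {suc (suc i)} {suc (suc j)} e →
          cong (λ i → suc (suc i)) (spare-injective (suc-injective (suc-injective e)))
      ; {zero}        {suc zero}    ()
      ; {zero}        {suc (suc _)} ()
      ; {suc zero}    {zero}        ()
      ; {suc zero}    {suc (suc _)} ()
      ; {suc (suc _)} {zero}        ()
      ; {suc (suc _)} {suc zero}    ()
      }
    ; spare-plain     = λ
      { zero          → ≡.refl
      ; (suc zero)    → ≡.refl
      ; (suc (suc i)) → ≡.trans (excess-≢ (fresh i)) (spare-plain i)
      }
    ; spare-divides   = λ
      { zero          → g , g-divides
      ; (suc zero)    → AbelianGroup._⁻¹ G g , divides-flip coordinates {p} {head h} {tail h} {g} g-divides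
      ; (suc (suc i)) → spare-divides i
      }
    }

module _ (d : ℕ) (G : Group₀) where
  open Cyclic d G
  open AbelianGroup G
  open Evaluation G
  private
    module G′ = AbelianGroup G′
    module EG′ = Evaluation G′

  inj-divides : ∀ p x y g → p · g ≈ x - y → p EG′.· inj g G′.≈ inj x G′.- inj y
  inj-divides p x y g e = G′.trans (G′.sym (homo-· G G′ inj inj-cong inj-homo p g))
    (G′.trans (inj-cong e) (homo-- G G′ inj inj-cong inj-homo x y))

addBead : ∀ {q G m} → Stage⁺ (2 + q) G (suc m) → Stage⁺ (2 + q) ((ℤ/ (2 + q)) ⊕ G) m
addBead {q} {G} (S , loopless) = record
  { map             = subdivide map x (suc q) 0
  ; spherical       = subdivide-spherical map x (suc q) 0 spherical (spare-plain 0F) λ ()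
  ; coordinates     = SubdivisionCoordinates.subdivide-coordinates map x (spare-plain 0F) q G coordinates
                        (proj₁ (spare-divides 0F)) (proj₂ (spare-divides 0F))
  ; spare           = λ i → suc (spare (suc i))
  ; spare-injective = λ e → suc-injective (spare-injective (suc-injective e))
  ; spare-plain     = λ i → ≡.trans (excess-≢ (other i)) (spare-plain (suc i))
  ; spare-divides   = λ i → inj (proj₁ (spare-divides (suc i))) , lifted i
  } , subdivide-loopless map x (suc q) 0 (λ a _ → loopless a)
  where
  open Stage S
  open Cyclic (2 + q) G
  open Coordinates coordinates using (label)
  x = spare 0F
  open Subdivision map x (suc q) 0 using (tail-≢; excess-≢)
  C′ = SubdivisionCoordinates.subdivide-coordinates map x (spare-plain 0F) q G coordinates
         (proj₁ (spare-divides 0F)) (proj₂ (spare-divides 0F))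

  other : ∀ i → spare (suc i) ≢ x
  other i e = contradiction (spare-injective e) λ ()

  lifted : ∀ i → Divisibility.Divides C′ (2 + q) (suc (head (spare (suc i))))
                   (Map.tail (subdivide map x (suc q) 0) (suc (spare (suc i))))
                   (inj (proj₁ (spare-divides (suc i))))
  lifted i = ≡.subst (λ t → Divisibility.Divides C′ (2 + q) (suc (head (spare (suc i)))) t
                              (inj (proj₁ (spare-divides (suc i)))))
    (≡.sym (tail-≢ (other i)))
    (inj-divides (2 + q) G (2 + q) (label (row (head (spare (suc i))))) (label (row (tail (spare (suc i)))))
      (proj₁ (spare-divides (suc i))) (proj₂ (spare-divides (suc i))))

addPetal : ∀ {q G m} a → 2 ≤ a → (S : Stage (2 + q) G (suc m)) → let open Stage S in
           (∀ b → b ≢ spare 0F → tail b ≢ head b) →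
           Stage⁺ (2 + q) ((ℤ/ ((2 + q) * a)) ⊕ G) (2 * (a ∸ 1) + suc m)
addPetal {q} {G} {m} (suc (suc r)) (s≤s (s≤s z≤n)) S loopless =
  -- Arc `2F` is the bundle of excess `a − 1` from `v` to `w`. The label of `v` exceeds that of `w`
  -- by `p` times `η`, hence the witness `η ⁻¹` for head minus tail.
  unbundleSpare (S′ , loopless′) 2F (suc r) ≡.refl (λ i → λ ()) (η ⁻¹ , tip-divides)
  where
  open Stage S
  open Cyclic ((2 + q) * (2 + r)) G
  open AbelianGroup G′
  open Evaluation G′
  open Coordinates coordinates using (label)
  x = spare 0F
  g = proj₁ (spare-divides 0F)
  M₁ M₂ M₃ : Map
  M₁ = subdivide map x (suc q) 0
  M₂ = unbundle M₁ 0F q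
  M₃ = petal map x q r

  open Subdivision map x (suc q) 0 using (tail-≢; excess-≢)
  C′ = PetalCoordinates.petal-coordinates map x (spare-plain 0F) q r G coordinates g (proj₂ (spare-divides 0F))

  other : ∀ i → spare (suc i) ≢ x
  other i e = contradiction (spare-injective e) λ ()

  tip-divides : Divisibility.Divides C′ (2 + q) (Map.head M₃ 2F) (Map.tail M₃ 2F) (η ⁻¹)
  tip-divides = trans (·-⁻¹ (2 + q) η)
    (linear (inj (label (row (tail x))) ∷ (2 + q) · η ∷ [])
      (⊟ gen 1F) (gen 0F ⊞ ⊟ (gen 0F ⊞ gen 1F)) ≡.refl)

  lifted : ∀ i → Divisibility.Divides C′ (2 + q) (suc (suc (head (spare (suc i)))))
                   (suc (Map.tail M₁ (suc (spare (suc i))))) (inj (proj₁ (spare-divides (suc i))))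
  lifted i = ≡.subst (λ t → Divisibility.Divides C′ (2 + q) (suc (suc (head (spare (suc i))))) (suc t)
                              (inj (proj₁ (spare-divides (suc i)))))
    (≡.sym (tail-≢ (other i)))
    (inj-divides ((2 + q) * (2 + r)) G (2 + q) (label (row (head (spare (suc i))))) (label (row (tail (spare (suc i)))))
      (proj₁ (spare-divides (suc i))) (proj₂ (spare-divides (suc i))))

  loopless′ : Loopless M₃
  loopless′ = subdivide-loopless M₂ 1F 0 (suc r)
    λ b _ → unbundle-loopless M₁ 0F q (subdivide-loopless map x (suc q) 0 loopless) b

  S′ : Stage (2 + q) G′ m
  S′ = record
    { map             = M₃
    ; spherical       = subdivide-spherical M₂ 1F 0 (suc r)
        (unbundle-spherical M₁ 0F q (subdivide-spherical map x (suc q) 0 spherical (spare-plain 0F) λ ()) λ ())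
        ≡.refl λ _ ()
    ; coordinates     = C′
    ; spare           = λ i → suc (suc (suc (suc (spare (suc i)))))
    ; spare-injective = λ e →
        suc-injective (spare-injective (suc-injective (suc-injective (suc-injective (suc-injective e)))))
    ; spare-plain     = λ i → ≡.trans (excess-≢ (other i)) (spare-plain (suc i))
    ; spare-divides   = λ i → inj (proj₁ (spare-divides (suc i))) , lifted i
    }

sum-update : ∀ {n} (f : Fin n → ℕ) i {j} → f i ≡ suc j → suc (sum (updateAt f i (const j))) ≡ sum f
sum-update f zero    {j} e = cong (_+ sum (f ∘ suc)) (≡.sym e)
sum-update f (suc i) {j} e = ≡.trans (≡.sym (ℕ.+-suc (f zero) _)) (cong (f zero ℕ.+_) (sum-update (f ∘ suc) i e))

sum≡0 : ∀ {n} (f : Fin n → ℕ) → sum f ≡ 0 → ∀ i → f i ≡ 0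
sum≡0 f e zero    = ℕ.m+n≡0⇒m≡0 (f zero) e
sum≡0 f e (suc i) = sum≡0 (f ∘ suc) (ℕ.m+n≡0⇒n≡0 (f zero) e) i

-- Terminates because `t` is the total excess, which every opening lowers by one.
unbundleAll : ∀ {G} t M → Spherical M → Loopless M → Coordinates M G → sum (Map.excess M) ≡ t →
              Σ Map λ M′ → Spherical M′ × Loopless M′ × Coordinates M′ G × (∀ a → Map.excess M′ a ≡ 0)
unbundleAll zero    M s l C e = M , s , l , C , sum≡0 (Map.excess M) e
unbundleAll {G} (suc t) M s l C e with any? (λ a → 1 ℕ.≤? Map.excess M a)
... | no plain      = M , s , l , C , λ a → ℕ.n≤0⇒n≡0 (ℕ.≮⇒≥ λ 1≤e → plain (a , 1≤e))
... | yes (f , 1≤e) = unbundleAll t (unbundle M f j) (unbundle-spherical M f j s (l f)) (unbundle-loopless M f j l)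
        (UnbundlingCoordinates.unbundle-coordinates M f j f-excess G C)
        (ℕ.suc-injective (≡.trans (sum-update (Map.excess M) f f-excess) e))
  where
  j = ℕ.pred (Map.excess M f)
  f-excess : Map.excess M f ≡ suc j
  f-excess = ≡.sym (ℕ.suc-pred (Map.excess M f) {{ℕ.>-nonZero 1≤e}})

realise : ∀ {p G m} → Stage⁺ p G m → Σ LatinBitrade λ T → IsSpherical T × canonicalGroup T ≅ G
realise {G = G} (S , loopless)
  with unbundleAll _ (Stage.map S) (Stage.spherical S) loopless (Stage.coordinates S) ≡.refl
... | M , s , l , C , plain =
  bitrade M s plain l a₀ , bitrade-spherical M s plain l a₀ , canonicalGroup-≅ M s plain l a₀ G C
  where a₀ = proj₁ (Spherical.row-occurs s (Coordinates.baseRow C))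

petals : ℕ → (k : ℕ) → Vector ℕ k → Group₀
petals p zero    a = ⨁ {k = 0} λ ()
petals p (suc k) a = (ℤ/ (p * a zero)) ⊕ petals p k (a ∘ suc)

beads : ℕ → ℕ → Group₀ → Group₀
beads p zero    G = G
beads p (suc n) G = (ℤ/ p) ⊕ beads p n G

-- The loop is spare since the difference along it is zero; it is the 1 in `spares`. The trivial
-- group is written as an empty direct sum, whose elements are functions on `Fin 0`, so that all its
-- equations hold vacuously.
loopStage : ∀ p a → Stage p (petals p 0 a) 1
loopStage p a = record
  { map             = singleLoop
  ; spherical       = singleLoop-spherical
  ; coordinates     = record
    { label       = λ _ ()
    ; label-model = λ _ ()
    ; word        = λ _ → 𝟎
    ; baseRow     = zero
    ; baseColumn  = zero
    ; word-cong   = λ H _ _ _ → AbelianGroup.refl H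
    ; word-homo   = λ H _ _ _ _ → AbelianGroup.sym H (AbelianGroup.identityˡ H _)
    ; word-label  = word-label
    ; label-word  = λ _ ()
    ; exponent    = 1 , s≤s z≤n , λ _ ()
    }
  ; spare           = λ _ → zero
  ; spare-injective = λ { {zero} {zero} _ → ≡.refl }
  ; spare-plain     = λ _ → ≡.refl
  ; spare-divides   = λ _ → (λ ()) , λ ()
  }
  where
  word-label : (H : Group₀) →
    let open AbelianGroup H
        open Evaluation H
    in ∀ ℓ → IsModel singleLoop H ℓ → ∀ v → ℓ v ≈ ε ∙ eval ℓ (baseTerm singleLoop zero zero v)
  word-label H ℓ model = λ
    { (row zero)    → sym (identityˡ _)
    ; (column zero) → sym (identityˡ _)
    ; (symbol zero) → linear-modulo (ℓ (row zero) ∷ ℓ (column zero) ∷ ℓ (symbol zero) ∷ [])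
        ((gen 0F ⊞ gen 1F ⊞ gen 2F ⊞ 𝟎) ∷ []) (λ { 0F → model zero }) (gen 0F)
        (gen 2F) (𝟎 ⊞ ⊟ (gen 0F ⊞ gen 1F)) ≡.refl
    }
    where
    open AbelianGroup H
    open Evaluation H

spares : ∀ k → Vector ℕ k → ℕ
spares k a = 1 + 2 * sum (λ i → a i ∸ 1)

mutual
  -- Two statements, as looplessness needs at least one petal. With none, the only loop is the spare
  -- arc that the first petal subdivides.
  petalStage : ∀ {q} k (a : Vector ℕ k) → (∀ i → 2 ≤ a i) →
               Σ (Stage (2 + q) (petals (2 + q) k a) (spares k a)) λ S → let open Stage S in
                 ∀ b → b ≢ spare 0F → tail b ≢ head b
  petalStage zero    a 2≤a = loopStage _ a , λ { zero 0≢0 → contradiction ≡.refl 0≢0 }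
  petalStage (suc k) a 2≤a with petalStage⁺ k a 2≤a
  ... | S , loopless = S , λ b _ → loopless b

  petalStage⁺ : ∀ {q} k (a : Vector ℕ (suc k)) → (∀ i → 2 ≤ a i) →
                Stage⁺ (2 + q) (petals (2 + q) (suc k) a) (spares (suc k) a)
  petalStage⁺ {q} k a 2≤a with petalStage {q} k (a ∘ suc) (2≤a ∘ suc)
  ... | S , loopless = ≡.subst (Stage⁺ (2 + q) _) (arith (a zero ∸ 1) (sum λ i → a (suc i) ∸ 1))
                         (addPetal (a zero) (2≤a zero) S loopless)
    where
    arith : ∀ x y → 2 * x + (1 + 2 * y) ≡ 1 + 2 * (x + y)
    arith = ℕSolver.solve-∀

beadStage : ∀ {q G} n r → Stage⁺ (2 + q) G (n + r) → Stage⁺ (2 + q) (beads (2 + q) n G) r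
beadStage         zero    r S = S
beadStage {q} {G} (suc n) r S =
  addBead (beadStage n (suc r) (≡.subst (Stage⁺ (2 + q) G) (≡.sym (ℕ.+-suc n r)) S))

-- The group as a direct sum

≅-trans : ∀ (A B C : Group₀) → A ≅ B → B ≅ C → A ≅ C
≅-trans A B C (f , i) (g , j) = g ∘ f , Composition.isGroupIsomorphism (AbelianGroup.trans C) i j

module _ {k} (F : Vector Group₀ (suc k)) {G : Group₀} where
  private
    module F i = AbelianGroup (F i)
    module G = AbelianGroup G

  ⊕-⨁ : G ≅ ⨁ (F ∘ suc) → F zero ⊕ G ≅ ⨁ F
  ⊕-⨁ (f , i) = isomorphism (F zero ⊕ G) (⨁ F)
    (λ { (x , y) zero → x ; (x , y) (suc j) → f y j })
    (λ { (e , e′) zero → e ; (e , e′) (suc j) → I.⟦⟧-cong e′ j })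
    (λ { (x , y) (x′ , y′) zero → F.refl zero ; (x , y) (x′ , y′) (suc j) → I.∙-homo y y′ j })
    (λ {(_ , y)} {(_ , y′)} e → e zero , I.injective {y} {y′} (e ∘ suc))
    (λ z → let y , e = I.surjective (z ∘ suc) in (z zero , y) , λ
      { zero → F.refl zero ; (suc j) → e G.refl j })
    where module I = GroupMorphisms.IsGroupIsomorphism i

  ⊕-⨁-⊕ : ∀ {K : Group₀} → G ≅ ⨁ (F ∘ suc) ⊕ K → F zero ⊕ G ≅ ⨁ F ⊕ K
  ⊕-⨁-⊕ {K} (f , i) = isomorphism (F zero ⊕ G) (⨁ F ⊕ K)
    (λ (x , y) → (λ { zero → x ; (suc j) → proj₁ (f y) j }) , proj₂ (f y))
    (λ (e , e′) → (λ { zero → e ; (suc j) → proj₁ (I.⟦⟧-cong e′) j }) , proj₂ (I.⟦⟧-cong e′))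
    (λ (x , y) (x′ , y′) →
      (λ { zero → F.refl zero ; (suc j) → proj₁ (I.∙-homo y y′) j }) , proj₂ (I.∙-homo y y′))
    (λ {(_ , y)} {(_ , y′)} (e , e′) → e zero , I.injective {y} {y′} (e ∘ suc , e′))
    (λ (z , z′) → let y , e = I.surjective (z ∘ suc , z′) in (z zero , y) ,
      (λ { zero → F.refl zero ; (suc j) → proj₁ (e G.refl) j }) , proj₂ (e G.refl))
    where module I = GroupMorphisms.IsGroupIsomorphism i

petals-≅ : ∀ p k (a : Vector ℕ k) → petals p k a ≅ ⨁ (λ i → ℤ/ (p * a i))
petals-≅ p zero    a = isomorphism (petals p 0 a) (⨁ (λ i → ℤ/ (p * a i)))
  (λ _ ()) (λ _ ()) (λ _ _ ()) (λ _ ()) (λ _ → (λ ()) , λ ())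
petals-≅ p (suc k) a = ⊕-⨁ (λ i → ℤ/ (p * a i)) {petals p k (a ∘ suc)} (petals-≅ p k (a ∘ suc))

beads-≅ : ∀ p n {G H : Group₀} → G ≅ H → beads p n G ≅ ⨁ (replicate n (ℤ/ p)) ⊕ H
beads-≅ p zero    {G} {H} (f , i) = isomorphism G (⨁ (replicate 0 (ℤ/ p)) ⊕ H)
  (λ x → (λ ()) , f x)
  (λ e → (λ ()) , I.⟦⟧-cong e)
  (λ x y → (λ ()) , I.∙-homo x y)
  (λ {x} {y} (_ , e) → I.injective {x} {y} e)
  (λ (_ , y) → let x , e = I.surjective y in x , (λ ()) , e (AbelianGroup.refl G))
  where module I = GroupMorphisms.IsGroupIsomorphism i
beads-≅ p (suc n) {G} {H} i = ⊕-⨁-⊕ (replicate (suc n) (ℤ/ p)) {beads p n G} {H} (beads-≅ p n {G} {H} i)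

theorem2p6 : (p : ℕ) → Prime p → (k : ℕ) → 1 ≤ k →
    (a : Vector ℕ k) → (∀ i → 2 ≤ a i) →
    (n : ℕ) → n ≤ 1 + 2 * (∑[ i < k ] (a i ∸ 1)) →
    Σ LatinBitrade (λ T → IsSpherical T ×
    canonicalGroup T ≅ (⨁ (replicate n (ℤ/ p)) ⊕ ⨁ (λ i → ℤ/ (p * a i))))
theorem2p6 p@(suc (suc q)) _ (suc k) _ a 2≤a n n≤ =
  -- The number inferred for the underscore is that of the spare arcs left after `n` beads, the
  -- bound minus `n`.
  let T , T-spherical , T-group = realise (beadStage n _
        (≡.subst (Stage⁺ p (petals p (suc k) a)) (≡.sym (ℕ.m+[n∸m]≡n n≤)) (petalStage⁺ k a 2≤a)))
  in T , T-spherical , ≅-trans (canonicalGroup T) (beads p n P) (⨁ (replicate n (ℤ/ p)) ⊕ Q) T-group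
       (beads-≅ p n {P} {Q} (petals-≅ p (suc k) a))
  where
  P Q : Group₀
  P = petals p (suc k) a
  Q = ⨁ (λ i → ℤ/ (p * a i))
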